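{- Let $k\ge 2$ be an integer and let $G$ be a connected finite simple graph with $\sigma_3 \ge t_{k+1}-2k+4$. Then $G$ has a dominating $k$-ended tree.
   Context: All graphs are finite, undirected, without loops or multiple edges. If the independence number of $G$ is at least 3, $\sigma_3$ denotes the minimum of $d(x)+d(y)+d(z)$ over all independent sets $\{x,y,z\}$ of three vertices; otherwise $\sigma_3=+\infty$. A leaf is a vertex of degree one; a tree is $k$-ended if it has at most $k$ leaves. For a positive integer $j$, $t_j$ denotes the order (number of vertices) of a largest $j$-ended tree in $G$ (with the paper's convention that a Hamilton cycle counts as a 1-ended tree, $t_1$ is the order of a longest cycle and $t_2$ the order of a longest path). A subgraph $T$ of $G$ is dominating if $V(G)\setminus V(T)$ is an independent set of vertices, i.e. $G-V(T)$ has no edges. -}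

module Defs where

open import Data.Nat using (ℕ; zero; suc; _+_; _*_; _≤_)
open import Data.Bool using (Bool; true; false; if_then_else_; _∧_)
open import Data.Fin using (Fin)
open import Data.List using (List; []; _∷_; _++_; [_]; length; map; allFin)
open import Data.Nat.ListAction using (sum)
open import Data.List.Relation.Unary.Linked using (Linked)
open import Data.List.Relation.Unary.Unique.Propositional using (Unique)
open import Data.Product using (Σ; ∃; _×_; _,_)
open import Relation.Binary.PropositionalEquality using (_≡_; _≢_)
open import Relation.Binary.Construct.Closure.ReflexiveTransitive using (Star)
open import Relation.Nullary using (¬_)

record Graph (n : ℕ) : Set where
  field
    adj    : Fin n → Fin n → Bool
    adj-sym    : ∀ x y → adj x y ≡ adj y x
    adj-irrefl : ∀ x → adj x x ≡ false
open Graph public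

count : {n : ℕ} → (Fin n → Bool) → ℕ
count {n} f = sum (map (λ u → if f u then 1 else 0) (allFin n))

Adj : {n : ℕ} → Graph n → Fin n → Fin n → Set
Adj G x y = adj G x y ≡ true

deg : {n : ℕ} → Graph n → Fin n → ℕ
deg G v = count (adj G v)

Connected : {n : ℕ} → Graph n → Set
Connected {n} G = Fin n × (∀ x y → Star (Adj G) x y)

record Subgraph {n : ℕ} (G : Graph n) : Set where
  field
    verts : Fin n → Bool
    edges : Fin n → Fin n → Bool
    edges-sub : ∀ x y → edges x y ≡ true → adj G x y ≡ true
    edges-sym : ∀ x y → edges x y ≡ edges y x
    edges-ends : ∀ x y → edges x y ≡ true → verts x ≡ true
open Subgraph public

module _ {n : ℕ} {G : Graph n} (T : Subgraph G) where

  Edge : Fin n → Fin n → Set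
  Edge x y = edges T x y ≡ true

  order : ℕ
  order = count (verts T)

  degT : Fin n → ℕ
  degT v = count (edges T v)

  isLeafB : Fin n → Bool
  isLeafB v = verts T v ∧ (degT v Data.Nat.≡ᵇ 1)

  leaves : ℕ
  leaves = count isLeafB

  SubConnected : Set
  SubConnected = (Σ (Fin n) λ v → verts T v ≡ true)
               × (∀ x y → verts T x ≡ true → verts T y ≡ true → Star Edge x y)

  HasCycle : Set
  HasCycle = Σ (Fin n) λ x → Σ (List (Fin n)) λ ys →
               (2 ≤ length ys) × Unique (x ∷ ys) × Linked Edge (x ∷ ys ++ [ x ])

  IsTree : Set
  IsTree = SubConnected × ¬ HasCycle

  KEnded : ℕ → Set
  KEnded k = leaves ≤ k

  Dominating : Set
  Dominating = ∀ x y → verts T x ≡ false → verts T y ≡ false → adj G x y ≡ false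

IsLargestTreeOrder : {n : ℕ} → Graph n → ℕ → ℕ → Set
IsLargestTreeOrder G j t =
  (Σ (Subgraph G) λ T → IsTree T × KEnded T j × order T ≡ t)
  × (∀ (T : Subgraph G) → IsTree T → KEnded T j → order T ≤ t)

IndepTriple : {n : ℕ} → Graph n → Fin n → Fin n → Fin n → Set
IndepTriple G x y z =
  x ≢ y × x ≢ z × y ≢ z
  × adj G x y ≡ false × adj G x z ≡ false × adj G y z ≡ false

module Submission where

-- Take a (k+1)-ended tree T of maximal order, and among these one with an edge bq, deg b ≥ 3, for which the
-- part of T beyond q is smallest.  If no k-ended tree dominates, then any k-ended tree extends by two vertices
-- to a (k+1)-ended tree; hence T has k+1 leaves, which are pairwise non-adjacent in G, have all their neighbours
-- in T, and hang from vertices of T-degree 2.  Edge exchanges carry these facts over to further optimal trees.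
--
-- Choose leaves x, y, z beyond three different neighbours of b, with z beyond q, and root T at x.  Let A be the
-- set of parents of vertices of N(x), without x itself, and let M consist of A, of N(y) ∩ N(z), and of the
-- leaves other than x, y, z.  Exchanges show that the parent map is injective on M and that the parents of M
-- avoid N(y) ∪ N(z) and the leaves other than x; minimality of bq is needed only for parents of N(y) ∩ N(z).
-- Counting vertices of T gives
--   (d(x) − 1) + |N(y) ∩ N(z)| + (k − 2) + |N(y) ∪ N(z)| + k ≤ |T|,
-- that is d(x) + d(y) + d(z) ≤ |T| − 2k + 3, contrary to the hypothesis.

open import Defs
open import Data.Nat using (ℕ; zero; suc; _+_; _*_; _≤_; _<_; _≤?_; _<?_; z≤n; s≤s; _≡ᵇ_)
open import Data.Nat.Properties
  using (≤-refl; ≤-trans; ≤-reflexive; ≤-antisym; ≤-pred; <-≤-trans; <-irrefl; <⇒≤; ≮⇒≥; ≰⇒>; ≤⇒≯; ≤∧≢⇒<; n≤1+n;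
         n≤0⇒n≡0; n≢0⇒n>0; m≤n⇒m≤1+n; m≤m+n; m≤n+m; m+n≡0⇒m≡0; m+n≡0⇒n≡0; suc-injective; ≡ᵇ⇒≡;
         +-comm; +-assoc; +-suc; +-identityʳ; +-mono-≤; +-monoˡ-≤; +-cancelʳ-≤; +-cancelʳ-≡;
         +-commutativeSemigroup; module ≤-Reasoning)
  renaming (_≟_ to _≟ℕ_)
open import Algebra.Properties.CommutativeSemigroup +-commutativeSemigroup
  using (interchange; xy∙z≈xz∙y; xy∙z≈x∙zy; x∙yz≈xz∙y)
open import Data.Bool using (Bool; true; false; if_then_else_; _∧_; _∨_; not) renaming (T to 𝕋)
open import Data.Bool.Properties using (∨-identityʳ; ∧-identityʳ; ∧-zeroʳ) renaming (_≟_ to _≟ᵇ_)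
open import Data.Empty using (⊥; ⊥-elim)
open import Data.Fin using (Fin; zero; suc)
open import Data.Fin.Properties using (_≟_; any?)
open import Data.List using (List; []; _∷_; _++_; [_]; map; allFin)
open import Data.List.Properties using (map-tabulate)
open import Data.List.Relation.Unary.All using (All; []; _∷_)
open import Data.List.Relation.Unary.AllPairs using ([]; _∷_)
open import Data.List.Relation.Unary.Linked using (Linked; []; _∷_)
open import Data.Nat.ListAction using (sum)
open import Data.Nat.Solver using (module +-*-Solver)
open import Data.Product using (Σ; ∃; _×_; _,_; proj₁; proj₂)
open import Data.Sum using (_⊎_; inj₁; inj₂; [_,_]′)
open import Data.Unit using (tt)
open import Function using (_∘_; id; mk⇔)
open import Relation.Binary.Construct.Closure.ReflexiveTransitive using (Star; ε; _◅_; _◅◅_; reverse)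
open import Relation.Binary.PropositionalEquality
  using (_≡_; _≢_; refl; sym; trans; cong; cong₂; subst; subst₂; module ≡-Reasoning)
open import Relation.Nullary using (¬_; Dec; yes; no; does; contradiction; _×-dec_; _⊎-dec_)
open import Relation.Nullary.Decidable using (dec-true; dec-false; does-⇔; toSum)

-- Writing d(y) + d(z) as |N(y) ∩ N(z)| + |N(y) ∪ N(z)| means that common neighbours of y and z are
-- charged twice, the second time to their parents. The parents of N(x) also avoid N(y) ∪ N(z), by a
-- single rotation, but they cannot be used directly: a vertex adjacent to x, y and z would yield
-- the same parent twice. The count therefore climbs one step further. A is disjoint from N(y) ∩
-- N(z), and injectivity of one parent map on their union keeps the charges apart. The obstacle is a
-- common neighbour whose parent is again adjacent to y or z. In most positions a rotation makes two
-- leaves adjacent. In the others the available exchanges keep the order without lowering the number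
-- of leaves, and progress shows only in the part of the tree beyond bq.

true⊎false : (b : Bool) → b ≡ true ⊎ b ≡ false
true⊎false true  = inj₁ refl
true⊎false false = inj₂ refl

clash : {A : Set} {b : Bool} → b ≡ true → b ≡ false → A
clash refl ()

witness : {A : Set} (a? : Dec A) → does a? ≡ true → A
witness (yes a) _ = a
witness (no _) ()

refutation : {A : Set} (a? : Dec A) → does a? ≡ false → ¬ A
refutation (yes _) ()
refutation (no ¬a) _ = ¬a

∧-left : ∀ {a b} → a ∧ b ≡ true → a ≡ true
∧-left {true} _ = refl

∧-right : ∀ {a b} → a ∧ b ≡ true → b ≡ true
∧-right {true} p = p

∧-intro : ∀ {a b} → a ≡ true → b ≡ true → a ∧ b ≡ true
∧-intro refl refl = refl

not-true : ∀ {b} → not b ≡ true → b ≡ false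
not-true {false} _ = refl

not-false : ∀ {b} → not b ≡ false → b ≡ true
not-false {true} _ = refl

-- Indicators, finite sums and counting

𝟙 : Bool → ℕ
𝟙 b = if b then 1 else 0

𝟙-true : ∀ {b} → b ≡ true → 𝟙 b ≡ 1
𝟙-true refl = refl

𝟙-false : ∀ {b} → b ≡ false → 𝟙 b ≡ 0
𝟙-false refl = refl

𝟙≤1 : ∀ b → 𝟙 b ≤ 1
𝟙≤1 true  = ≤-refl
𝟙≤1 false = z≤n

δ : ∀ {n} → Fin n → Fin n → ℕ
δ v u = 𝟙 (does (u ≟ v))

δ-refl : ∀ {n} (v : Fin n) → δ v v ≡ 1
δ-refl v = 𝟙-true (dec-true (v ≟ v) refl)

δ-≢ : ∀ {n} {u v : Fin n} → u ≢ v → δ v u ≡ 0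
δ-≢ {u = u} {v} u≢v = 𝟙-false (dec-false (u ≟ v) u≢v)

δ≡0⇒≢ : ∀ {n} {u v : Fin n} → δ v u ≡ 0 → u ≢ v
δ≡0⇒≢ {v = v} p refl with () ← trans (sym (δ-refl v)) p

∑ : ∀ {n} → (Fin n → ℕ) → ℕ
∑ {n} g = sum (map g (allFin n))

module _ {A : Set} where

  sum-mono : {f g : A → ℕ} → (∀ u → f u ≤ g u) → ∀ xs → sum (map f xs) ≤ sum (map g xs)
  sum-mono le []       = z≤n
  sum-mono le (x ∷ xs) = +-mono-≤ (le x) (sum-mono le xs)

  sum-+ : (f g : A → ℕ) → ∀ xs → sum (map (λ u → f u + g u) xs) ≡ sum (map f xs) + sum (map g xs)
  sum-+ f g []       = refl
  sum-+ f g (x ∷ xs) = trans (cong (f x + g x +_) (sum-+ f g xs)) (interchange (f x) (g x) _ _)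

  sum-cong : {f g : A → ℕ} → (∀ u → f u ≡ g u) → ∀ xs → sum (map f xs) ≡ sum (map g xs)
  sum-cong eq []       = refl
  sum-cong eq (x ∷ xs) = cong₂ _+_ (eq x) (sum-cong eq xs)

  sum-pick : {f g : A → ℕ} → ∀ xs → sum (map f xs) < sum (map g xs) → ∃ λ u → f u < g u
  sum-pick {f} {g} (x ∷ xs) lt with f x <? g x
  ... | yes p = x , p
  ... | no ¬p = sum-pick xs (≰⇒> λ ge → <-irrefl refl (<-≤-trans lt (+-mono-≤ (≮⇒≥ ¬p) ge)))

module _ {n : ℕ} where

  ∑-mono : {f g : Fin n → ℕ} → (∀ u → f u ≤ g u) → ∑ f ≤ ∑ g
  ∑-mono le = sum-mono le (allFin n)

  ∑-+ : (f g : Fin n → ℕ) → ∑ (λ u → f u + g u) ≡ ∑ f + ∑ g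
  ∑-+ f g = sum-+ f g (allFin n)

  ∑-pick : {f g : Fin n → ℕ} → ∑ f < ∑ g → ∃ λ u → f u < g u
  ∑-pick = sum-pick (allFin n)

  ∑-cong : {f g : Fin n → ℕ} → (∀ u → f u ≡ g u) → ∑ f ≡ ∑ g
  ∑-cong eq = sum-cong eq (allFin n)

∑-suc : ∀ {n} (g : Fin (suc n) → ℕ) → ∑ g ≡ g zero + ∑ (g ∘ suc)
∑-suc g = cong (λ l → g zero + sum l) (trans (map-tabulate suc g) (sym (map-tabulate id (g ∘ suc))))

∑-0 : ∀ n → ∑ {n} (λ _ → 0) ≡ 0
∑-0 zero    = refl
∑-0 (suc n) = trans (∑-suc {n} (λ _ → 0)) (∑-0 n)

∑-δ : ∀ {n} (v : Fin n) → ∑ (δ v) ≡ 1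
∑-δ {suc n} zero    = trans (∑-suc (δ {suc n} zero)) (cong suc (∑-0 n))
∑-δ {suc n} (suc v) = trans (∑-suc (δ (suc v))) (trans (∑-cong eq) (∑-δ v))
  where
  eq : ∀ u → δ (suc v) (suc u) ≡ δ v u
  eq u = refl

module _ {n : ℕ} where

  count-mono : {f g : Fin n → Bool} → (∀ u → f u ≡ true → g u ≡ true) → count f ≤ count g
  count-mono {f} {g} imp = ∑-mono le
    where
    le : ∀ u → 𝟙 (f u) ≤ 𝟙 (g u)
    le u with f u in fu
    ... | false = z≤n
    ... | true  = ≤-reflexive (sym (𝟙-true (imp u fu)))

  δ≤𝟙 : {f : Fin n → Bool} {a : Fin n} → f a ≡ true → ∀ u → δ a u ≤ 𝟙 (f u)
  δ≤𝟙 {f} {a} fa u with u ≟ a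
  ... | yes refl = ≤-reflexive (sym (𝟙-true fa))
  ... | no _     = z≤n

  1≤count : (f : Fin n → Bool) {a : Fin n} → f a ≡ true → 1 ≤ count f
  1≤count f {a} fa = ≤-trans (≤-reflexive (sym (∑-δ a))) (∑-mono (δ≤𝟙 fa))

  count-drop : {f g : Fin n → Bool} {a : Fin n} → (∀ u → g u ≡ true → f u ≡ true × u ≢ a) → f a ≡ true → count g < count f
  count-drop {f} {g} {a} imp fa = ≤-trans (≤-reflexive eq) (∑-mono le)
    where
    eq : suc (count g) ≡ ∑ (λ u → δ a u + 𝟙 (g u))
    eq = sym (trans (∑-+ (δ a) (𝟙 ∘ g)) (cong (_+ count g) (∑-δ a)))
    le : ∀ u → δ a u + 𝟙 (g u) ≤ 𝟙 (f u)
    le u with g u in gu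
    ... | false = ≤-trans (≤-reflexive (+-identityʳ _)) (δ≤𝟙 fa u)
    ... | true  = ≤-reflexive (trans (cong (_+ 1) (δ-≢ (proj₂ (imp u gu)))) (sym (𝟙-true (proj₁ (imp u gu)))))

  count-remove : (f : Fin n → Bool) (a : Fin n) → count f ≤ suc (count (λ u → f u ∧ not (does (u ≟ a))))
  count-remove f a = ≤-trans (∑-mono le) (≤-reflexive (trans (∑-+ (δ a) (𝟙 ∘ g)) (cong (_+ count g) (∑-δ a))))
    where
    g : Fin n → Bool
    g u = f u ∧ not (does (u ≟ a))
    le : ∀ u → 𝟙 (f u) ≤ δ a u + 𝟙 (f u ∧ not (does (u ≟ a)))
    le u with f u | u ≟ a
    ... | false | _     = z≤n
    ... | true  | yes _ = ≤-refl
    ... | true  | no _  = ≤-refl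

  2≤count : (f : Fin n → Bool) {a b : Fin n} → f a ≡ true → f b ≡ true → b ≢ a → 2 ≤ count f
  2≤count f {a} {b} fa fb b≢a =
    ≤-trans (s≤s (1≤count (λ u → f u ∧ not (does (u ≟ a))) {b} (∧-intro fb (cong not (dec-false (b ≟ a) b≢a)))))
            (count-drop (λ u p → ∧-left p , λ u≡a → clash (∧-right {f u} p) (cong not (dec-true (u ≟ a) u≡a))) fa)

  3≤count : (f : Fin n → Bool) {a b c : Fin n} →
            f a ≡ true → f b ≡ true → f c ≡ true → b ≢ a → c ≢ a → c ≢ b → 3 ≤ count f
  3≤count f {a} {b} {c} fa fb fc b≢a c≢a c≢b =
    ≤-trans (s≤s (2≤count (λ u → f u ∧ not (does (u ≟ a)))
                          (∧-intro fb (cong not (dec-false (b ≟ a) b≢a)))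
                          (∧-intro fc (cong not (dec-false (c ≟ a) c≢a))) c≢b))
            (count-drop (λ u p → ∧-left p , λ u≡a → clash (∧-right {f u} p) (cong not (dec-true (u ≟ a) u≡a))) fa)

  -- Pigeonhole. In the uses below `g` is zero or a sum of `δ`s at the vertices to be avoided.
  count-pick : {f : Fin n → Bool} {g : Fin n → ℕ} → ∑ g < count f → ∃ λ u → f u ≡ true × g u ≡ 0
  count-pick {f} {g} lt with u , p ← ∑-pick {f = g} {𝟙 ∘ f} lt = u , go (f u) (g u) p
    where
    go : ∀ b m → m < 𝟙 b → b ≡ true × m ≡ 0
    go true zero _ = refl , refl
    go true (suc m) (s≤s ())

  pick₁ : (f : Fin n → Bool) → 1 ≤ count f → ∃ λ u → f u ≡ true
  pick₁ f le with u , p , _ ← count-pick {f} {λ _ → 0} (≤-trans (≤-reflexive (cong suc (∑-0 n))) le) = u , p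

  pick₂ : (f : Fin n → Bool) → 2 ≤ count f → ∀ a → ∃ λ u → f u ≡ true × u ≢ a
  pick₂ f le a with u , p , q ← count-pick {f} {δ a} (≤-trans (≤-reflexive (cong suc (∑-δ a))) le) =
    u , p , δ≡0⇒≢ q

  pick₃ : (f : Fin n → Bool) → 3 ≤ count f → ∀ a b → ∃ λ u → f u ≡ true × u ≢ a × u ≢ b
  pick₃ f le a b
    with u , p , q ← count-pick {f} {λ u → δ a u + δ b u}
           (≤-trans (≤-reflexive (cong suc (trans (∑-+ (δ a) (δ b)) (cong₂ _+_ (∑-δ a) (∑-δ b))))) le) =
    u , p , δ≡0⇒≢ (m+n≡0⇒m≡0 _ q) , δ≡0⇒≢ (m+n≡0⇒n≡0 (δ a u) q)

-- side u v w tells whether w lies in the component of v after deleting the edge uv; such a colouring for every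
-- edge makes all edges bridges, and is easier to carry through an edge exchange than the absence of cycles.
record Tree {n : ℕ} (G : Graph n) : Set where
  field
    sub  : Subgraph G
    base : Σ (Fin n) λ v → verts sub v ≡ true
    conn : ∀ x y → verts sub x ≡ true → verts sub y ≡ true → Star (Edge sub) x y
    side : Fin n → Fin n → Fin n → Bool
    side-src   : ∀ {u v} → Edge sub u v → side u v u ≡ false
    side-tgt   : ∀ {u v} → Edge sub u v → side u v v ≡ true
    side-cross : ∀ {u v e f} → Edge sub u v → Edge sub e f →
                 side u v e ≡ false → side u v f ≡ true → e ≡ u × f ≡ v
open Tree public

-- Sides, directions and leaves of a tree

module _ {n : ℕ} {G : Graph n} (T : Tree G) where

  In : Fin n → Set
  In v = verts (sub T) v ≡ true

  E : Fin n → Fin n → Set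
  E = Edge (sub T)

  Side Off : Fin n → Fin n → Fin n → Set
  Side u v w = side T u v w ≡ true
  Off u v w = side T u v w ≡ false

  dg : Fin n → ℕ
  dg = degT (sub T)

  Leaf : Fin n → Set
  Leaf v = In v × dg v ≡ 1

  numLeaves size : ℕ
  numLeaves = leaves (sub T)
  size = order (sub T)

  inSide : Fin n → Fin n → Fin n → Bool
  inSide u v w = verts (sub T) w ∧ side T u v w

  sideSize : Fin n → Fin n → ℕ
  sideSize u v = count (inSide u v)

module _ {n : ℕ} {G : Graph n} (T : Tree G) where
  private
    variable
      a b e f u v w : Fin n

  E-sym : E T u v → E T v u
  E-sym {u} {v} uv = trans (sym (edges-sym (sub T) u v)) uv

  E-src : E T u v → In T u
  E-src {u} {v} = edges-ends (sub T) u v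

  E-tgt : E T u v → In T v
  E-tgt uv = E-src (E-sym uv)

  E-adj : E T u v → Adj G u v
  E-adj {u} {v} = edges-sub (sub T) u v

  E-≢ : E T u v → u ≢ v
  E-≢ {u} uv refl = clash (E-adj uv) (adj-irrefl G u)

  -- Connectedness as an induction principle: the lemmas on sides below choose a property that no
  -- edge of the tree destroys.
  walk : {P : Fin n → Set} → (∀ {e f} → E T e f → P e → P f) → In T u → In T w → P u → P w
  walk {u} {w} {P} closed u∈ w∈ = go (conn T u w u∈ w∈)
    where
    go : ∀ {x} → Star (E T) x w → P x → P w
    go ε        p = p
    go (s ◅ ss) p = go ss (closed s p)

  -- A walk from `u` is always at `u` or beyond some edge at `u`, since the only way out of the part
  -- beyond `uv` is back through `u`.
  toward : In T u → In T w → u ≢ w → ∃ λ v → E T u v × Side T u v w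
  toward {u} {w} u∈ w∈ u≢w = [ (λ w≡u → contradiction (sym w≡u) u≢w) , id ]′ (walk step u∈ w∈ (inj₁ refl))
    where
    P : Fin n → Set
    P x = x ≡ u ⊎ ∃ λ v → E T u v × Side T u v x
    step : ∀ {e f} → E T e f → P e → P f
    step {f = f} ef (inj₁ refl) = inj₂ (f , ef , side-tgt T ef)
    step {f = f} ef (inj₂ (v , uv , s)) with true⊎false (side T u v f)
    ... | inj₁ t = inj₂ (v , uv , t)
    ... | inj₂ o = inj₁ (proj₁ (side-cross T uv (E-sym ef) o s))

  -- If `a` and `b` differed, no edge could leave the intersection of the two sides: an edge leaving
  -- the first is `au`, and `a` lies beyond `ub` only if it is `b`. The walk from `w` to `u` would
  -- then place `u` beyond its own edge.
  toward-unique : E T u a → E T u b → In T w → Side T u a w → Side T u b w → a ≡ b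
  toward-unique {u} {a} {b} {w} ua ub w∈ sa sb with a ≟ b
  ... | yes a≡b = a≡b
  ... | no  a≢b = clash (proj₁ (walk step w∈ (E-src ua) (sa , sb))) (side-src T ua)
    where
    P : Fin n → Set
    P x = Side T u a x × Side T u b x
    step : ∀ {e f} → E T e f → P e → P f
    step {f = f} ef (s , t) with true⊎false (side T u a f) | true⊎false (side T u b f)
    ... | inj₁ p | inj₁ q = p , q
    ... | inj₂ p | _ with refl , refl ← side-cross T ua (E-sym ef) p s =
      contradiction (proj₂ (side-cross T ub ua (side-src T ub) t)) a≢b
    ... | inj₁ _ | inj₂ q with refl , refl ← side-cross T ub (E-sym ef) q t =
      contradiction (sym (proj₂ (side-cross T ua ub (side-src T ua) s))) a≢b

  -- The colourings of `uv` and `vu` are separate data in `Tree`. That they are complementary on the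
  -- vertices of the tree follows here and in `Off⇒Side`, because the set where they agree is closed
  -- under edges.
  Side⇒Off : E T u v → In T w → Side T u v w → Off T v u w
  Side⇒Off {u} {v} {w} uv w∈ s with true⊎false (side T v u w)
  ... | inj₂ o = o
  ... | inj₁ t = clash (proj₁ (walk step w∈ (E-src uv) (s , t))) (side-src T uv)
    where
    P : Fin n → Set
    P x = Side T u v x × Side T v u x
    step : ∀ {e f} → E T e f → P e → P f
    step {f = f} ef (s , t) with true⊎false (side T u v f) | true⊎false (side T v u f)
    ... | inj₁ p | inj₁ q = p , q
    ... | inj₂ p | _ with refl , refl ← side-cross T uv (E-sym ef) p s = clash t (side-src T (E-sym uv))
    ... | inj₁ _ | inj₂ q with refl , refl ← side-cross T (E-sym uv) (E-sym ef) q t = clash s (side-src T uv)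

  Off⇒Side : E T u v → In T w → Off T u v w → Side T v u w
  Off⇒Side {u} {v} {w} uv w∈ s with true⊎false (side T v u w)
  ... | inj₁ o = o
  ... | inj₂ t = clash (side-tgt T (E-sym uv)) (proj₂ (walk step w∈ (E-src uv) (s , t)))
    where
    P : Fin n → Set
    P x = Off T u v x × Off T v u x
    step : ∀ {e f} → E T e f → P e → P f
    step {f = f} ef (s , t) with true⊎false (side T u v f) | true⊎false (side T v u f)
    ... | inj₂ p | inj₂ q = p , q
    ... | inj₁ p | _ with refl , refl ← side-cross T uv ef s p = clash (side-tgt T (E-sym uv)) t
    ... | inj₂ _ | inj₁ q with refl , refl ← side-cross T (E-sym uv) ef t q = clash (side-tgt T uv) s

  side-nested : ∀ {w₀} → E T e f → E T b a → Off T e f b → Side T e f w₀ → In T w₀ → Side T b a w₀ →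
                In T w → Side T e f w → Side T b a w
  side-nested {e} {f} {b} {a} {w} {w₀} ef ba b∉ s₀ w₀∈ t₀ w∈ s =
    [ proj₂ , (λ (o , _) → clash s o) ]′ (walk step w₀∈ w∈ (inj₁ (s₀ , t₀)))
    where
    P : Fin n → Set
    -- Outside the part beyond `ef` the walk remembers only that `f` is beyond `ba`, which suffices
    -- because re-entry is possible at `f` alone.
    P x = (Side T e f x × Side T b a x) ⊎ (Off T e f x × Side T b a f)
    step : ∀ {x y} → E T x y → P x → P y
    step {x} {y} xy (inj₁ (s , t)) with true⊎false (side T e f y) | true⊎false (side T b a y)
    ... | inj₁ p | inj₁ q = inj₁ (p , q)
    ... | inj₁ p | inj₂ q with refl , refl ← side-cross T ba (E-sym xy) q t = clash p b∉
    ... | inj₂ p | _ with refl , refl ← side-cross T ef (E-sym xy) p s = inj₂ (p , t)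
    step {x} {y} xy (inj₂ (o , t)) with true⊎false (side T e f y)
    ... | inj₂ p = inj₂ (p , t)
    ... | inj₁ p with refl , refl ← side-cross T ef xy o p = inj₁ (p , t)

  -- Induction over the subtree beyond `uv`: a walk that leaves it can come back only at `v`, where
  -- `P` is known.
  side-⊆ : {P : Fin n → Set} → E T u v → P v →
           (∀ {e f} → E T e f → Side T u v e → Side T u v f → P e → P f) → In T w → Side T u v w → P w
  side-⊆ {u} {v} {w} {P} uv pv closed w∈ s =
    [ proj₂ , (λ o → clash s o) ]′ (walk step (E-tgt uv) w∈ (inj₁ (side-tgt T uv , pv)))
    where
    Q : Fin n → Set
    Q x = (Side T u v x × P x) ⊎ Off T u v x
    step : ∀ {x y} → E T x y → Q x → Q y
    step {x} {y} xy q with true⊎false (side T u v y)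
    ... | inj₂ o = inj₂ o
    step xy (inj₁ (s , p)) | inj₁ t = inj₁ (t , closed xy s t p)
    step xy (inj₂ o) | inj₁ t with refl , refl ← side-cross T uv xy o t = inj₁ (t , pv)

  dg≥1 : E T u v → 1 ≤ dg T u
  dg≥1 {u} = 1≤count (edges (sub T) u)

  dg≥2 : E T u a → E T u b → b ≢ a → 2 ≤ dg T u
  dg≥2 {u} = 2≤count (edges (sub T) u)

  leaf-nbr : dg T u ≡ 1 → E T u a → E T u b → a ≡ b
  leaf-nbr {u} {a} {b} d ua ub with a ≟ b
  ... | yes p = p
  ... | no ¬p with s≤s () ← subst (2 ≤_) d (dg≥2 ub ua ¬p)

  side-leaf : E T u v → dg T v ≡ 1 → In T w → Side T u v w → w ≡ v
  side-leaf {u} {v} uv d = side-⊆ {P = _≡ v} uv refl closed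
    where
    closed : ∀ {e f} → E T e f → Side T u v e → Side T u v f → e ≡ v → f ≡ v
    closed ef _ t refl with refl ← leaf-nbr d ef (E-sym uv) = clash t (side-src T uv)

  Off-leaf : Leaf T w → E T w v → In T u → u ≢ w → Side T w v u
  Off-leaf (w∈ , d) wv u∈ u≢w with true⊎false (side T _ _ _)
  ... | inj₁ s = s
  ... | inj₂ o = contradiction (side-leaf (E-sym wv) d u∈ (Off⇒Side wv u∈ o)) u≢w

  side-next : E T u v → E T v w → w ≢ u → In T a → Side T v w a → Side T u v a
  side-next {u} {v} {w} uv vw w≢u = side-⊆ vw w-in closed
    where
    w-in : Side T u v w
    w-in with true⊎false (side T u v w)
    ... | inj₁ p = p
    ... | inj₂ p with refl , _ ← side-cross T uv (E-sym vw) p (side-tgt T uv) = contradiction refl w≢u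
    closed : ∀ {e f} → E T e f → Side T v w e → Side T v w f → Side T u v e → Side T u v f
    closed {e} {f} ef s _ t with true⊎false (side T u v f)
    ... | inj₁ p = p
    ... | inj₂ p with refl , refl ← side-cross T uv (E-sym ef) p t = clash s (side-src T vw)

  -- The measure for recursions that move outwards in the tree: each step drops `v` from the side.
  sideSize-next : E T u v → E T v w → w ≢ u → sideSize T v w < sideSize T u v
  sideSize-next {u} {v} {w} uv vw w≢u = count-drop sub′ (∧-intro (E-tgt uv) (side-tgt T uv))
    where
    sub′ : ∀ x → inSide T v w x ≡ true → inSide T u v x ≡ true × x ≢ v
    sub′ x p = ∧-intro (∧-left p) (side-next uv vw w≢u (∧-left p) s) , λ { refl → clash s (side-src T vw) }
      where s = ∧-right {verts (sub T) x} p

  sideSize-pos : E T u v → 1 ≤ sideSize T u v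
  sideSize-pos {u} {v} uv = 1≤count (inSide T u v) (∧-intro (E-tgt uv) (side-tgt T uv))

module _ {n : ℕ} {G : Graph n} (T : Tree G) where
  private
    variable
      a b e f u v w x y : Fin n

  leaf-beyond : E T u v → ∃ λ w → Leaf T w × Side T u v w
  leaf-beyond uv = go _ uv ≤-refl
    where
    go : ∀ m {u v} → E T u v → sideSize T u v ≤ m → ∃ λ w → Leaf T w × Side T u v w
    go zero uv le = contradiction (≤-trans (sideSize-pos T uv) le) λ ()
    go (suc m) {u} {v} uv le with dg T v ≟ℕ 1
    ... | yes d = v , (E-tgt T uv , d) , side-tgt T uv
    ... | no ¬d
      with x , vx , x≢u ← pick₂ (edges (sub T) v) (≤∧≢⇒< (dg≥1 T (E-sym T uv)) (¬d ∘ sym)) u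
      with w , lw , s ← go m vx (≤-pred (≤-trans (sideSize-next T uv vx x≢u) le)) =
      w , lw , side-next T uv vx x≢u (proj₁ lw) s

  -- Descend from `uv` while `y` and `w` lie in the same direction. Where the directions part, the
  -- vertex has the neighbour it was entered from and two different ones towards `y` and `w`.
  branch-between : E T u v → Leaf T y → Leaf T w → y ≢ w → Side T u v y → Side T u v w →
                   ∃ λ b → ∃ λ q → E T b q × 3 ≤ dg T b × Side T b q y × Off T b q w
  branch-between {y = y} {w = w} uv (y∈ , dy) (w∈ , dw) y≢w = go _ uv ≤-refl
    where
    q≢u′ : ∀ {u v q} → E T u v → Side T u v y → Side T v q y → q ≢ u
    q≢u′ uv sy tq refl = clash tq (Side⇒Off T uv y∈ sy)
    go : ∀ m {u v} → E T u v → sideSize T u v ≤ m → Side T u v y → Side T u v w →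
         ∃ λ b → ∃ λ q → E T b q × 3 ≤ dg T b × Side T b q y × Off T b q w
    go zero uv le = contradiction (≤-trans (sideSize-pos T uv) le) λ ()
    go (suc m) {u} {v} uv le sy sw with v ≟ y | v ≟ w
    ... | yes refl | _ = contradiction (sym (side-leaf T uv dy w∈ sw)) y≢w
    ... | _ | yes refl = contradiction (side-leaf T uv dw y∈ sy) y≢w
    ... | no v≢y | no v≢w
      with q , vq , tq ← toward T (E-tgt T uv) y∈ v≢y
      with r , vr , tr ← toward T (E-tgt T uv) w∈ v≢w
      with q≢u ← q≢u′ uv sy tq
      with true⊎false (side T v q w)
    ... | inj₁ s = go m vq (≤-pred (≤-trans (sideSize-next T uv vq q≢u) le)) tq s
    ... | inj₂ o = v , q , vq , 3≤count (edges (sub T) v) (E-sym T uv) vq vr q≢u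
                     (λ { refl → clash tr (Side⇒Off T uv w∈ sw) }) (λ { refl → clash tr o }) , tq , o

  -- A cycle that starts with the edge from `x` to `y₁` stays beyond that edge until it returns to
  -- `x`, and it can return only from `y₁`, which it has already used.
  no-cycle : ¬ HasCycle (sub T)
  no-cycle (x , [] , () , _)
  no-cycle (x , _ ∷ [] , s≤s () , _)
  no-cycle (x , y₁ ∷ y₂ ∷ ys , _ , ((_ ∷ x≢) ∷ y₁≢ ∷ _) , xy ∷ path) =
    go y₁ (y₂ ∷ ys) (side-tgt T xy) (λ ()) x≢ y₁≢ path
    where
    -- At the start `y` is `y₁` itself, so the inequality is required only at the last vertex before
    -- the return to `x`.
    go : ∀ y zs → Side T x y₁ y → (zs ≡ [] → y ≢ y₁) → All (x ≢_) zs → All (y₁ ≢_) zs →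
         Linked (E T) (y ∷ zs ++ [ x ]) → ⊥
    go y [] s y≢ _ _ (yx ∷ _) = y≢ refl (proj₂ (side-cross T xy (E-sym T yx) (side-src T xy) s))
    go y (z ∷ zs) s _ (x≢z ∷ x≢) (y₁≢z ∷ y₁≢) (yz ∷ path) with true⊎false (side T x y₁ z)
    ... | inj₁ t = go z zs t (λ _ → y₁≢z ∘ sym) x≢ y₁≢ path
    ... | inj₂ o = x≢z (sym (proj₁ (side-cross T xy (E-sym T yz) o s)))

  isTree : IsTree (sub T)
  isTree = (base T , conn T) , no-cycle

-- Exchanging an edge, adding and deleting a leaf

𝟙-del : {A : Set} → ∀ r (a? : Dec A) → (A → r ≡ true) → 𝟙 (r ∧ not (does a?)) + 𝟙 (does a?) ≡ 𝟙 r
𝟙-del true  (yes _) _ = refl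
𝟙-del true  (no _)  _ = refl
𝟙-del false (yes a) h = clash (h a) refl
𝟙-del false (no _)  _ = refl

𝟙-add : {A : Set} → ∀ r (a? : Dec A) → (A → r ≡ false) → 𝟙 (r ∨ does a?) ≡ 𝟙 r + 𝟙 (does a?)
𝟙-add true  (yes a) h = clash refl (h a)
𝟙-add true  (no _)  _ = refl
𝟙-add false (yes _) _ = refl
𝟙-add false (no _)  _ = refl

module _ {n : ℕ} where

  Joins : Fin n → Fin n → Fin n → Fin n → Set
  Joins c d x y = (x ≡ c × y ≡ d) ⊎ (x ≡ d × y ≡ c)

  joins? : ∀ c d x y → Dec (Joins c d x y)
  joins? c d x y = (x ≟ c ×-dec y ≟ d) ⊎-dec (x ≟ d ×-dec y ≟ c)

  Joins-swap : ∀ {c d x y} → Joins c d x y → Joins c d y x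
  Joins-swap (inj₁ (p , q)) = inj₂ (q , p)
  Joins-swap (inj₂ (p , q)) = inj₁ (q , p)

  joins-swap : ∀ c d x y → does (joins? c d x y) ≡ does (joins? c d y x)
  joins-swap c d x y = does-⇔ (mk⇔ Joins-swap Joins-swap) (joins? c d x y) (joins? c d y x)

  count-joins : ∀ {c d} → c ≢ d → ∀ x → count (λ y → does (joins? c d x y)) ≡ δ c x + δ d x
  count-joins {c} {d} c≢d x with x ≟ c | x ≟ d
  ... | yes refl | yes refl = contradiction refl c≢d
  ... | yes refl | no _ = trans (∑-cong {g = δ d} λ y → cong 𝟙 (∨-identityʳ (does (y ≟ d)))) (∑-δ d)
  ... | no _ | yes refl = ∑-δ c
  ... | no _ | no _ = ∑-0 n

  module _ (R : Fin n → Fin n → Bool) (c d : Fin n) where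

    delEdge addEdge : Fin n → Fin n → Bool
    delEdge x y = R x y ∧ not (does (joins? c d x y))
    addEdge x y = R x y ∨ does (joins? c d x y)

    delEdge⁻ : ∀ {x y} → delEdge x y ≡ true → R x y ≡ true × ¬ Joins c d x y
    delEdge⁻ {x} {y} p = ∧-left p , refutation (joins? c d x y) (not-true (∧-right {R x y} p))

    delEdge⁺ : ∀ {x y} → R x y ≡ true → ¬ Joins c d x y → delEdge x y ≡ true
    delEdge⁺ {x} {y} r ¬j = ∧-intro r (cong not (dec-false (joins? c d x y) ¬j))

    addEdge⁻ : ∀ {x y} → addEdge x y ≡ true → R x y ≡ true ⊎ Joins c d x y
    addEdge⁻ {x} {y} p with R x y
    ... | true  = inj₁ refl
    ... | false = inj₂ (witness (joins? c d x y) p)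

    addEdge⁺ˡ : ∀ {x y} → R x y ≡ true → addEdge x y ≡ true
    addEdge⁺ˡ {x} {y} r rewrite r = refl

    addEdge⁺ʳ : ∀ {x y} → Joins c d x y → addEdge x y ≡ true
    addEdge⁺ʳ {x} {y} j with R x y
    ... | true  = refl
    ... | false = dec-true (joins? c d x y) j

    module _ (R-sym : ∀ x y → R x y ≡ R y x) where

      delEdge-sym : ∀ x y → delEdge x y ≡ delEdge y x
      delEdge-sym x y = cong₂ (λ r j → r ∧ not j) (R-sym x y) (joins-swap c d x y)

      addEdge-sym : ∀ x y → addEdge x y ≡ addEdge y x
      addEdge-sym x y = cong₂ _∨_ (R-sym x y) (joins-swap c d x y)

      count-delEdge : c ≢ d → R c d ≡ true → ∀ x → count (delEdge x) + (δ c x + δ d x) ≡ count (R x)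
      count-delEdge c≢d r x = trans (cong (count (delEdge x) +_) (sym (count-joins c≢d x)))
                                    (trans (sym (∑-+ (𝟙 ∘ delEdge x) _)) (∑-cong eq))
        where
        eq : ∀ y → 𝟙 (delEdge x y) + 𝟙 (does (joins? c d x y)) ≡ 𝟙 (R x y)
        eq y = 𝟙-del (R x y) (joins? c d x y) λ
          { (inj₁ (refl , refl)) → r ; (inj₂ (refl , refl)) → trans (R-sym _ _) r }

      count-addEdge : c ≢ d → R c d ≡ false → ∀ x → count (addEdge x) ≡ count (R x) + (δ c x + δ d x)
      count-addEdge c≢d r x = trans (trans (∑-cong eq) (∑-+ (𝟙 ∘ R x) _)) (cong (count (R x) +_) (count-joins c≢d x))
        where
        eq : ∀ y → 𝟙 (addEdge x y) ≡ 𝟙 (R x y) + 𝟙 (does (joins? c d x y))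
        eq y = 𝟙-add (R x y) (joins? c d x y) λ
          { (inj₁ (refl , refl)) → r ; (inj₂ (refl , refl)) → trans (R-sym _ _) r }

module Exchange {n : ℕ} {G : Graph n} (T : Tree G) {c d a e : Fin n}
  (cd : E T c d) (a∈ : In T a) (e∈ : In T e) (a-off : Off T c d a) (e-side : Side T c d e) (ae : Adj G a e) where

  private
    R⁻ R′ : Fin n → Fin n → Bool
    R⁻ = delEdge (edges (sub T)) c d
    R′ = addEdge R⁻ a e

    E′ : Fin n → Fin n → Set
    E′ x y = R′ x y ≡ true

    a≢e : a ≢ e
    a≢e refl = clash e-side a-off

  E⁻ : ∀ {x y} → E′ x y → (E T x y × ¬ Joins c d x y) ⊎ Joins a e x y
  E⁻ {x} {y} p with addEdge⁻ R⁻ a e {x} {y} p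
  ... | inj₁ q = inj₁ (delEdge⁻ (edges (sub T)) c d q)
  ... | inj₂ j = inj₂ j

  kept : ∀ {x y} → E T x y → ¬ Joins c d x y → E′ x y
  kept xy ¬j = addEdge⁺ˡ R⁻ a e (delEdge⁺ (edges (sub T)) c d xy ¬j)

  new : E′ a e
  new = addEdge⁺ʳ R⁻ a e (inj₁ (refl , refl))

  private
    R′-sym : ∀ x y → R′ x y ≡ R′ y x
    R′-sym = addEdge-sym R⁻ a e (delEdge-sym (edges (sub T)) c d (edges-sym (sub T)))

    E′-sym : ∀ {x y} → E′ x y → E′ y x
    E′-sym {x} {y} p = trans (R′-sym y x) p

  sub′ : Subgraph G
  sub′ .verts = verts (sub T)
  sub′ .edges = R′
  sub′ .edges-sub x y p with E⁻ p
  ... | inj₁ (q , _) = E-adj T q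
  ... | inj₂ (inj₁ (refl , refl)) = ae
  ... | inj₂ (inj₂ (refl , refl)) = trans (adj-sym G e a) ae
  sub′ .edges-sym = R′-sym
  sub′ .edges-ends x y p with E⁻ p
  ... | inj₁ (q , _) = E-src T q
  ... | inj₂ (inj₁ (refl , refl)) = a∈
  ... | inj₂ (inj₂ (refl , refl)) = e∈

  private
    P : Fin n → Set
    P x = (Side T c d x × Star E′ d x) ⊎ (Off T c d x × Star E′ c x)

    reach : ∀ {x} → In T x → P x
    reach x∈ = walk T step (E-src T cd) x∈ (inj₂ (side-src T cd , ε))
      where
      step : ∀ {x y} → E T x y → P x → P y
      step {x} {y} xy p with true⊎false (side T c d y)
      step xy (inj₁ (s , p)) | inj₁ t = inj₁ (t , p ◅◅ kept xy
        (λ { (inj₁ (refl , _)) → clash s (side-src T cd) ; (inj₂ (_ , refl)) → clash t (side-src T cd) }) ◅ ε)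
      step xy (inj₂ (o , p)) | inj₁ t with refl , refl ← side-cross T cd xy o t = inj₁ (t , ε)
      step xy (inj₁ (s , p)) | inj₂ o with refl , refl ← side-cross T cd (E-sym T xy) o s = inj₂ (o , ε)
      step xy (inj₂ (o , p)) | inj₂ o′ = inj₂ (o′ , p ◅◅ kept xy
        (λ { (inj₁ (_ , refl)) → clash (side-tgt T cd) o′ ; (inj₂ (refl , _)) → clash (side-tgt T cd) o }) ◅ ε)

    c→a : Star E′ c a
    c→a with reach a∈
    ... | inj₁ (s , _) = clash s a-off
    ... | inj₂ (_ , p) = p

    d→e : Star E′ d e
    d→e with reach e∈
    ... | inj₁ (_ , p) = p
    ... | inj₂ (o , _) = clash e-side o

    from-c : ∀ {x} → In T x → Star E′ c x
    from-c x∈ with reach x∈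
    ... | inj₁ (_ , p) = (c→a ◅◅ new ◅ reverse E′-sym d→e) ◅◅ p
    ... | inj₂ (_ , p) = p

    s : Fin n → Bool
    s = side T c d

    anchor : Bool → Fin n
    anchor β = if β then e else a

    -- Collapses the side of cd not labelled β onto the endpoint of ae labelled β.
    ρ : Bool → Fin n → Fin n
    ρ β w with s w ≟ᵇ β
    ... | yes _ = w
    ... | no _  = anchor β

    ρ-same : ∀ {β w} → s w ≡ β → ρ β w ≡ w
    ρ-same {β} {w} p with s w ≟ᵇ β
    ... | yes _ = refl
    ... | no ¬p = contradiction p ¬p

    ρ-other : ∀ {β w} → s w ≢ β → ρ β w ≡ anchor β
    ρ-other {β} {w} ¬p with s w ≟ᵇ β
    ... | yes p = contradiction p ¬p
    ... | no _  = refl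

    ρ-new : ∀ β → ρ β a ≡ ρ β e
    ρ-new true  = trans (ρ-other λ p → clash p a-off) (sym (ρ-same e-side))
    ρ-new false = trans (ρ-same a-off) (sym (ρ-other λ p → clash e-side p))

    old-same : ∀ {x y} → E T x y → ¬ Joins c d x y → s x ≡ s y
    old-same {x} {y} xy ¬j with true⊎false (s x) | true⊎false (s y)
    ... | inj₁ p | inj₁ q = trans p (sym q)
    ... | inj₂ p | inj₂ q = trans p (sym q)
    ... | inj₁ p | inj₂ q = contradiction (inj₂ (let (u , v) = side-cross T cd (E-sym T xy) q p in v , u)) ¬j
    ... | inj₂ p | inj₁ q = contradiction (inj₁ (side-cross T cd xy p q)) ¬j

    -- The new edge `ae` separates what `cd` separated. Any other edge lies within one component of
    -- T minus `cd`, and the whole other component now hangs from it through `ae`, so it takes the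
    -- colour of the endpoint of `ae` on the near side.
    side′ : Fin n → Fin n → Fin n → Bool
    side′ u v w with u ≟ a ×-dec v ≟ e | u ≟ e ×-dec v ≟ a
    ... | yes _ | _     = s w
    ... | no _  | yes _ = not (s w)
    ... | no _  | no _  = side T u v (ρ (s u) w)

    src′ : ∀ {u v} → E′ u v → side′ u v u ≡ false
    src′ {u} {v} uv with u ≟ a ×-dec v ≟ e | u ≟ e ×-dec v ≟ a
    ... | yes (refl , refl) | _     = a-off
    ... | no _  | yes (refl , refl) = cong not e-side
    ... | no ¬p | no ¬q with E⁻ uv
    ... | inj₁ (q , _) = trans (cong (side T u v) (ρ-same refl)) (side-src T q)
    ... | inj₂ j = contradiction j [ ¬p , ¬q ]′

    tgt′ : ∀ {u v} → E′ u v → side′ u v v ≡ true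
    tgt′ {u} {v} uv with u ≟ a ×-dec v ≟ e | u ≟ e ×-dec v ≟ a
    ... | yes (refl , refl) | _     = e-side
    ... | no _  | yes (refl , refl) = cong not a-off
    ... | no ¬p | no ¬q with E⁻ uv
    ... | inj₁ (q , ¬j) = trans (cong (side T u v) (ρ-same (sym (old-same q ¬j)))) (side-tgt T q)
    ... | inj₂ j = contradiction j [ ¬p , ¬q ]′

    s-cross : ∀ {f g} → E′ f g → s f ≡ false → s g ≡ true → f ≡ a × g ≡ e
    s-cross fg sf sg with E⁻ fg
    ... | inj₁ (q , ¬j) = clash sg (trans (sym (old-same q ¬j)) sf)
    ... | inj₂ (inj₁ p) = p
    ... | inj₂ (inj₂ (refl , refl)) = clash e-side sf

    cross-old : ∀ {u v f g} → E T u v → E T f g → s f ≡ s g → side T u v (ρ (s u) f) ≡ false →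
                side T u v (ρ (s u) g) ≡ true → Dec (s f ≡ s u) → f ≡ u × g ≡ v
    cross-old {u} {v} uv fg f~g p q (yes f~u) =
      side-cross T uv fg (trans (cong (side T u v) (sym (ρ-same f~u))) p)
                         (trans (cong (side T u v) (sym (ρ-same (trans (sym f~g) f~u)))) q)
    cross-old {u} {v} uv fg f~g p q (no f≁u) =
      clash (trans (cong (side T u v) (trans (ρ-other f≁u) (sym (ρ-other (f≁u ∘ trans f~g))))) q) p

    cross′ : ∀ {u v f g} → E′ u v → E′ f g → side′ u v f ≡ false → side′ u v g ≡ true → f ≡ u × g ≡ v
    cross′ {u} {v} {f} {g} uv fg p q with u ≟ a ×-dec v ≟ e | u ≟ e ×-dec v ≟ a
    ... | yes (refl , refl) | _ = s-cross fg p q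
    ... | no _ | yes (refl , refl) =
      let (x , y) = s-cross (E′-sym fg) (not-true q) (not-false p) in y , x
    ... | no ¬p | no ¬q with E⁻ uv
    ... | inj₂ j = contradiction j [ ¬p , ¬q ]′
    ... | inj₁ (uv₀ , ¬j) with E⁻ fg
    ... | inj₂ (inj₁ (refl , refl)) = clash q (trans (cong (side T u v) (sym (ρ-new (s u)))) p)
    ... | inj₂ (inj₂ (refl , refl)) = clash q (trans (cong (side T u v) (ρ-new (s u))) p)
    ... | inj₁ (fg₀ , ¬i) = cross-old uv₀ fg₀ (old-same fg₀ ¬i) p q (s f ≟ᵇ s u)

  tree : Tree G
  tree .sub = sub′
  tree .base = base T
  tree .conn x y x∈ y∈ = reverse E′-sym (from-c x∈) ◅◅ from-c y∈
  tree .side = side′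
  tree .side-src = src′
  tree .side-tgt = tgt′
  tree .side-cross = cross′

  -- Only `cd` joins the two sides, and it has been removed. The case where `ae` is `cd` itself is
  -- thereby allowed.
  new-edge-absent : R⁻ a e ≡ false
  new-edge-absent with true⊎false (R⁻ a e)
  ... | inj₂ p = p
  ... | inj₁ p with q , ¬j ← delEdge⁻ (edges (sub T)) c d p = contradiction (inj₁ (side-cross T cd q a-off e-side)) ¬j

  -- Keeping the corrections additive on both sides avoids subtraction and covers coinciding
  -- endpoints, such as `a` equal to `c`, without case distinctions.
  dg-exchange : ∀ v → dg tree v + (δ c v + δ d v) ≡ dg T v + (δ a v + δ e v)
  dg-exchange v = begin
    dg tree v + (δ c v + δ d v)
      ≡⟨ cong (_+ (δ c v + δ d v)) (count-addEdge R⁻ a e (delEdge-sym (edges (sub T)) c d (edges-sym (sub T))) a≢e new-edge-absent v) ⟩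
    count (R⁻ v) + (δ a v + δ e v) + (δ c v + δ d v)
      ≡⟨ xy∙z≈xz∙y (count (R⁻ v)) _ _ ⟩
    count (R⁻ v) + (δ c v + δ d v) + (δ a v + δ e v)
      ≡⟨ cong (_+ (δ a v + δ e v)) (count-delEdge (edges (sub T)) c d (edges-sym (sub T)) (E-≢ T cd) cd v) ⟩
    dg T v + (δ a v + δ e v) ∎
    where open ≡-Reasoning

𝟙leaf : Bool → ℕ → ℕ
𝟙leaf β m = 𝟙 (β ∧ (m ≡ᵇ 1))

𝟙leaf≤1 : ∀ β m → 𝟙leaf β m ≤ 1
𝟙leaf≤1 β m = 𝟙≤1 (β ∧ (m ≡ᵇ 1))

𝟙leaf-branch : ∀ β {m} → 2 ≤ m → 𝟙leaf β m ≡ 0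
𝟙leaf-branch true  (s≤s (s≤s _)) = refl
𝟙leaf-branch false _ = refl

𝟙leaf-out : ∀ {β} m → β ≡ false → 𝟙leaf β m ≡ 0
𝟙leaf-out m refl = refl

module _ {n : ℕ} {G : Graph n} (T : Tree G) where

  leaf⇒isLeafB : ∀ {v} → Leaf T v → isLeafB (sub T) v ≡ true
  leaf⇒isLeafB (v∈ , d) = ∧-intro v∈ (cong (_≡ᵇ 1) d)

  isLeafB⇒leaf : ∀ {v} → isLeafB (sub T) v ≡ true → Leaf T v
  isLeafB⇒leaf {v} p = ∧-left p , ≡ᵇ⇒≡ (dg T v) 1 (subst 𝕋 (sym (∧-right {verts (sub T) v} p)) tt)

  𝟙leaf-leaf : ∀ {v} → Leaf T v → 𝟙leaf (verts (sub T) v) (dg T v) ≡ 1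
  𝟙leaf-leaf l = 𝟙-true (leaf⇒isLeafB l)

  pos-degree : ∀ {u v} → In T u → In T v → u ≢ v → 1 ≤ dg T u
  pos-degree u∈ v∈ u≢v = let (_ , uw , _) = toward T u∈ v∈ u≢v in dg≥1 T uw

module AddLeaf {n : ℕ} {G : Graph n} (T : Tree G) {u v : Fin n}
  (u∈ : In T u) (v∉ : verts (sub T) v ≡ false) (uv : Adj G u v) where

  private
    R′ : Fin n → Fin n → Bool
    R′ = addEdge (edges (sub T)) u v

    V′ : Fin n → Bool
    V′ w = verts (sub T) w ∨ does (w ≟ v)

    E′ : Fin n → Fin n → Set
    E′ x y = R′ x y ≡ true

    E⁻ : ∀ {x y} → E′ x y → E T x y ⊎ Joins u v x y
    E⁻ = addEdge⁻ (edges (sub T)) u v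

    kept : ∀ {x y} → E T x y → E′ x y
    kept = addEdge⁺ˡ (edges (sub T)) u v

  new : E′ u v
  new = addEdge⁺ʳ (edges (sub T)) u v (inj₁ (refl , refl))

  private
    E′-sym : ∀ {x y} → E′ x y → E′ y x
    E′-sym {x} {y} p = trans (addEdge-sym (edges (sub T)) u v (edges-sym (sub T)) y x) p

    V⁺ˡ : ∀ {w} → In T w → V′ w ≡ true
    V⁺ˡ p rewrite p = refl

    V⁻ : ∀ {w} → V′ w ≡ true → In T w ⊎ w ≡ v
    V⁻ {w} p with verts (sub T) w
    ... | true  = inj₁ refl
    ... | false = inj₂ (witness (w ≟ v) p)

  v∈′ : V′ v ≡ true
  v∈′ with verts (sub T) v
  ... | true  = refl
  ... | false = dec-true (v ≟ v) refl

  private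
    ≢v : ∀ {w} → In T w → w ≢ v
    ≢v p refl = clash p v∉

  sub′ : Subgraph G
  sub′ .verts = V′
  sub′ .edges = R′
  sub′ .edges-sub x y p with E⁻ p
  ... | inj₁ q = E-adj T q
  ... | inj₂ (inj₁ (refl , refl)) = uv
  ... | inj₂ (inj₂ (refl , refl)) = trans (adj-sym G v u) uv
  sub′ .edges-sym = addEdge-sym (edges (sub T)) u v (edges-sym (sub T))
  sub′ .edges-ends x y p with E⁻ p
  ... | inj₁ q = V⁺ˡ (E-src T q)
  ... | inj₂ (inj₁ (refl , refl)) = V⁺ˡ u∈
  ... | inj₂ (inj₂ (refl , refl)) = v∈′

  private
    lift : ∀ {x y} → Star (E T) x y → Star E′ x y
    lift ε = ε
    lift (s ◅ ss) = kept s ◅ lift ss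

    from-u : ∀ {x} → V′ x ≡ true → Star E′ u x
    from-u x∈ with V⁻ x∈
    ... | inj₁ p = lift (conn T _ _ u∈ p)
    ... | inj₂ refl = new ◅ ε

    retract : Fin n → Fin n
    retract w with w ≟ v
    ... | yes _ = u
    ... | no _  = w

    retract-old : ∀ {w} → w ≢ v → retract w ≡ w
    retract-old {w} w≢v with w ≟ v
    ... | yes p = contradiction p w≢v
    ... | no _  = refl

    retract-new : retract u ≡ retract v
    retract-new with u ≟ v | v ≟ v
    ... | _     | no v≢v = contradiction refl v≢v
    ... | yes _ | yes _  = refl
    ... | no _  | yes _  = refl

    -- The new edge cuts off `v` alone, and every old edge sees `v` where it sees `u`. The two
    -- equality tests are arguments so that proofs can match on them directly.
    sideBy : ∀ {x y} → Dec (x ≡ v) → Dec (y ≡ v) → Fin n → Bool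
    sideBy (yes _) _ w       = not (does (w ≟ v))
    sideBy (no _)  (yes _) w = does (w ≟ v)
    sideBy {x} {y} (no _) (no _) w = side T x y (retract w)

    old : ∀ {x y} → x ≢ v → y ≢ v → E′ x y → E T x y
    old x≢v y≢v p with E⁻ p
    ... | inj₁ q = q
    ... | inj₂ (inj₁ (_ , q)) = contradiction q y≢v
    ... | inj₂ (inj₂ (q , _)) = contradiction q x≢v

    at-v : ∀ {y} → E′ v y → y ≡ u
    at-v p with E⁻ p
    ... | inj₁ q = clash (E-src T q) v∉
    ... | inj₂ (inj₁ (v≡u , _)) = contradiction (sym v≡u) (≢v u∈)
    ... | inj₂ (inj₂ (_ , q)) = q

    u≢v : u ≢ v
    u≢v = ≢v u∈

    src′ : ∀ {x y} → E′ x y → (p : Dec (x ≡ v)) (q : Dec (y ≡ v)) → sideBy p q x ≡ false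
    src′ xy (yes refl) _ = cong not (dec-true (v ≟ v) refl)
    src′ xy (no x≢v) (yes _) = dec-false (_ ≟ v) x≢v
    src′ {x} {y} xy (no x≢v) (no y≢v) = trans (cong (side T x y) (retract-old x≢v)) (side-src T (old x≢v y≢v xy))

    tgt′ : ∀ {x y} → E′ x y → (p : Dec (x ≡ v)) (q : Dec (y ≡ v)) → sideBy p q y ≡ true
    tgt′ {y = y} xy (yes refl) _ = cong not (dec-false (y ≟ v) (subst (_≢ v) (sym (at-v xy)) u≢v))
    tgt′ xy (no _) (yes refl) = dec-true (v ≟ v) refl
    tgt′ {x} {y} xy (no x≢v) (no y≢v) = trans (cong (side T x y) (retract-old y≢v)) (side-tgt T (old x≢v y≢v xy))

    cross-old : ∀ {x y e f} → E T x y → E′ e f → side T x y (retract e) ≡ false →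
                side T x y (retract f) ≡ true → e ≡ x × f ≡ y
    cross-old {x} {y} xy ef p q with E⁻ ef
    ... | inj₂ (inj₁ (refl , refl)) = clash (trans (cong (side T x y) retract-new) q) p
    ... | inj₂ (inj₂ (refl , refl)) = clash q (trans (cong (side T x y) retract-new) p)
    ... | inj₁ ef₀ = side-cross T xy ef₀ (trans (cong (side T x y) (sym (retract-old (≢v (E-src T ef₀))))) p)
                                        (trans (cong (side T x y) (sym (retract-old (≢v (E-tgt T ef₀))))) q)

    cross′ : ∀ {x y e f} → E′ x y → E′ e f → (p : Dec (x ≡ v)) (q : Dec (y ≡ v)) →
             sideBy p q e ≡ false → sideBy p q f ≡ true → e ≡ x × f ≡ y
    cross′ {e = e} xy ef (yes refl) _ p q with refl ← witness (e ≟ v) (not-false p) =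
      refl , trans (at-v ef) (sym (at-v xy))
    cross′ {f = f} xy ef (no _) (yes refl) p q with refl ← witness (f ≟ v) q =
      trans (at-v (E′-sym ef)) (sym (at-v (E′-sym xy))) , refl
    cross′ xy ef (no x≢v) (no y≢v) p q = cross-old (old x≢v y≢v xy) ef p q

  tree : Tree G
  tree .sub = sub′
  tree .base = u , V⁺ˡ u∈
  tree .conn x y x∈ y∈ = reverse E′-sym (from-u x∈) ◅◅ from-u y∈
  tree .side x y = sideBy (x ≟ v) (y ≟ v)
  tree .side-src p = src′ p (_ ≟ v) (_ ≟ v)
  tree .side-tgt p = tgt′ p (_ ≟ v) (_ ≟ v)
  tree .side-cross p q = cross′ p q (_ ≟ v) (_ ≟ v)

  size-add : size tree ≡ suc (size T)
  size-add = trans (∑-cong λ w → 𝟙-add (verts (sub T) w) (w ≟ v) λ { refl → v∉ })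
                   (trans (∑-+ (𝟙 ∘ verts (sub T)) (δ v)) (trans (cong (size T +_) (∑-δ v)) (+-comm (size T) 1)))

  private
    absent : edges (sub T) u v ≡ false
    absent with true⊎false (edges (sub T) u v)
    ... | inj₁ p = clash (E-tgt T p) v∉
    ... | inj₂ p = p

  dg-add : ∀ w → dg tree w ≡ dg T w + (δ u w + δ v w)
  dg-add = count-addEdge (edges (sub T)) u v (edges-sym (sub T)) u≢v absent

  new-leaf : Leaf tree v
  new-leaf = v∈′ , ≤-antisym (≤-pred (≰⇒> λ le → two (pick₂ (R′ v) le u))) (1≤count (R′ v) (E′-sym new))
    where
    two : (∃ λ w → E′ v w × w ≢ u) → ⊥
    two (w , vw , w≢u) = w≢u (at-v vw)

  private
    lf lf′ : Fin n → ℕ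
    lf w  = 𝟙leaf (verts (sub T) w) (dg T w)
    lf′ w = 𝟙leaf (V′ w) (dg tree w)

    lf-other : ∀ {w} → w ≢ u → w ≢ v → lf′ w ≡ lf w
    lf-other {w} w≢u w≢v = cong₂ 𝟙leaf
      (trans (cong (verts (sub T) w ∨_) (dec-false (w ≟ v) w≢v)) (∨-identityʳ _))
      (trans (dg-add w) (trans (cong (dg T w +_) (cong₂ _+_ (δ-≢ w≢u) (δ-≢ w≢v))) (+-identityʳ _)))

    lf-u : 1 ≤ dg T u → lf′ u ≡ 0
    lf-u d = 𝟙leaf-branch (V′ u) (≤-trans (+-mono-≤ d (≤-trans (≤-reflexive (sym (δ-refl u))) (m≤m+n _ _)))
                                          (≤-reflexive (sym (dg-add u))))

    lf-v : ∀ {m} → lf′ v ≤ m + δ v v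
    lf-v {m} = ≤-trans (𝟙leaf≤1 (V′ v) (dg tree v)) (≤-trans (≤-reflexive (sym (δ-refl v))) (m≤n+m _ m))

  leaves-add : 1 ≤ dg T u → numLeaves tree ≤ suc (numLeaves T)
  leaves-add d = ≤-trans (∑-mono le)
    (≤-reflexive (trans (∑-+ lf (δ v)) (trans (cong (numLeaves T +_) (∑-δ v)) (+-comm _ 1))))
    where
    le : ∀ w → lf′ w ≤ lf w + δ v w
    le w = [ at-u , (λ w≢u → [ (λ { refl → lf-v {lf w} }) , other w≢u ]′ (toSum (w ≟ v))) ]′ (toSum (w ≟ u))
      where
      at-u : w ≡ u → lf′ w ≤ lf w + δ v w
      at-u refl = ≤-trans (≤-reflexive (lf-u d)) z≤n
      other : w ≢ u → w ≢ v → lf′ w ≤ lf w + δ v w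
      other p q = ≤-trans (≤-reflexive (lf-other p q)) (m≤m+n _ _)

  leaves-leaf : Leaf T u → numLeaves tree ≤ numLeaves T
  leaves-leaf l = +-cancelʳ-≤ 1 _ _ (begin
    numLeaves tree + 1         ≡⟨ cong (numLeaves tree +_) (sym (∑-δ u)) ⟩
    numLeaves tree + ∑ (δ u)   ≡⟨ sym (∑-+ lf′ (δ u)) ⟩
    ∑ (λ w → lf′ w + δ u w)    ≤⟨ ∑-mono le ⟩
    ∑ (λ w → lf w + δ v w)     ≡⟨ ∑-+ lf (δ v) ⟩
    numLeaves T + ∑ (δ v)      ≡⟨ cong (numLeaves T +_) (∑-δ v) ⟩
    numLeaves T + 1            ∎)
    where
    open ≤-Reasoning
    le : ∀ w → lf′ w + δ u w ≤ lf w + δ v w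
    le w = [ at-u , (λ w≢u → [ at-v′ w≢u , other w≢u ]′ (toSum (w ≟ v))) ]′ (toSum (w ≟ u))
      where
      at-u : w ≡ u → lf′ w + δ u w ≤ lf w + δ v w
      at-u refl = ≤-trans (≤-reflexive (trans (cong₂ _+_ (lf-u (≤-reflexive (sym (proj₂ l)))) (δ-refl u))
                                              (sym (𝟙leaf-leaf T l)))) (m≤m+n _ _)
      at-v′ : w ≢ u → w ≡ v → lf′ w + δ u w ≤ lf w + δ v w
      at-v′ w≢u refl = ≤-trans (≤-reflexive (trans (cong (lf′ w +_) (δ-≢ w≢u)) (+-identityʳ _))) (lf-v {lf w})
      other : w ≢ u → w ≢ v → lf′ w + δ u w ≤ lf w + δ v w
      other w≢u w≢v = ≤-reflexive (cong₂ _+_ (lf-other w≢u w≢v) (trans (δ-≢ w≢u) (sym (δ-≢ w≢v))))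

  -- A single vertex has degree zero and is not counted as a leaf, so its first extension creates
  -- two leaves at once and escapes `leaves-add`.
  leaves-isolated : dg T u ≡ 0 → numLeaves tree ≤ 2
  leaves-isolated d = ≤-trans (∑-mono le) (≤-reflexive (trans (∑-+ (δ u) (δ v)) (cong₂ _+_ (∑-δ u) (∑-δ v))))
    where
    le : ∀ w → lf′ w ≤ δ u w + δ v w
    le w = [ at-u , (λ w≢u → [ (λ { refl → lf-v {δ u w} }) , other w≢u ]′ (toSum (w ≟ v))) ]′ (toSum (w ≟ u))
      where
      at-u : w ≡ u → lf′ w ≤ δ u w + δ v w
      at-u refl = ≤-trans (𝟙leaf≤1 (V′ w) (dg tree w)) (≤-trans (≤-reflexive (sym (δ-refl u))) (m≤m+n _ _))
      other : w ≢ u → w ≢ v → lf′ w ≤ δ u w + δ v w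
      other w≢u w≢v with true⊎false (verts (sub T) w)
      ... | inj₁ w∈ = contradiction (≤-trans (pos-degree T u∈ w∈ (w≢u ∘ sym)) (≤-reflexive d)) λ ()
      ... | inj₂ w∉ = ≤-trans (≤-reflexive (trans (lf-other w≢u w≢v) (𝟙leaf-out (dg T w) w∉))) z≤n

module DelLeaf {n : ℕ} {G : Graph n} (T : Tree G) {w w′ : Fin n} (lw : Leaf T w) (ww′ : E T w w′) where

  private
    R′ : Fin n → Fin n → Bool
    R′ = delEdge (edges (sub T)) w w′

    V′ : Fin n → Bool
    V′ x = verts (sub T) x ∧ not (does (x ≟ w))

    E′ : Fin n → Fin n → Set
    E′ x y = R′ x y ≡ true

    E⁻ : ∀ {x y} → E′ x y → E T x y × ¬ Joins w w′ x y
    E⁻ = delEdge⁻ (edges (sub T)) w w′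

    kept : ∀ {x y} → E T x y → x ≢ w → y ≢ w → E′ x y
    kept xy x≢w y≢w = delEdge⁺ (edges (sub T)) w w′ xy
      λ { (inj₁ (p , _)) → x≢w p ; (inj₂ (_ , p)) → y≢w p }

    V⁺ : ∀ {x} → In T x → x ≢ w → V′ x ≡ true
    V⁺ {x} p x≢w = ∧-intro p (cong not (dec-false (x ≟ w) x≢w))

    V⁻ : ∀ {x} → V′ x ≡ true → x ≢ w
    V⁻ {x} p = refutation (x ≟ w) (not-true (∧-right {verts (sub T) x} p))

    at-w : ∀ {y} → E T w y → y ≡ w′
    at-w wy = leaf-nbr T (proj₂ lw) wy ww′

    src-≢ : ∀ {x y} → E′ x y → x ≢ w
    src-≢ p refl with q , ¬j ← E⁻ p = ¬j (inj₁ (refl , at-w q))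

  sub′ : Subgraph G
  sub′ .verts = V′
  sub′ .edges = R′
  sub′ .edges-sub x y p = E-adj T (proj₁ (E⁻ p))
  sub′ .edges-sym = delEdge-sym (edges (sub T)) w w′ (edges-sym (sub T))
  sub′ .edges-ends x y p = V⁺ (E-src T (proj₁ (E⁻ p))) (src-≢ p)

  private
    retract : Fin n → Fin n
    retract x with x ≟ w
    ... | yes _ = w′
    ... | no _  = x

    retract-old : ∀ {x} → x ≢ w → retract x ≡ x
    retract-old {x} x≢w with x ≟ w
    ... | yes p = contradiction p x≢w
    ... | no _  = refl

    retract-step : ∀ {x y} → E T x y → Star E′ (retract x) (retract y)
    retract-step {x} {y} xy with x ≟ w | y ≟ w
    ... | yes refl | yes refl = ε
    ... | yes refl | no _ with refl ← at-w xy = ε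
    ... | no _ | yes refl with refl ← at-w (E-sym T xy) = ε
    ... | no p | no q = kept xy p q ◅ ε

    retract-path : ∀ {x y} → Star (E T) x y → Star E′ (retract x) (retract y)
    retract-path ε = ε
    retract-path (s ◅ ss) = retract-step s ◅◅ retract-path ss

  tree : Tree G
  tree .sub = sub′
  tree .base = w′ , V⁺ (E-tgt T ww′) (E-≢ T ww′ ∘ sym)
  tree .conn x y x∈ y∈ = subst (λ z → Star E′ z y) (retract-old (V⁻ x∈))
    (subst (Star E′ (retract x)) (retract-old (V⁻ y∈)) (retract-path (conn T x y (∧-left x∈) (∧-left y∈))))
  tree .side = side T
  tree .side-src p = side-src T (proj₁ (E⁻ p))
  tree .side-tgt p = side-tgt T (proj₁ (E⁻ p))
  tree .side-cross p q = side-cross T (proj₁ (E⁻ p)) (proj₁ (E⁻ q))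

  size-del : suc (size tree) ≡ size T
  size-del = sym (trans (trans (∑-cong λ x → sym (𝟙-del (verts (sub T) x) (x ≟ w) λ { refl → proj₁ lw }))
                               (∑-+ (𝟙 ∘ V′) (δ w)))
                        (trans (cong (size tree +_) (∑-δ w)) (+-comm (size tree) 1)))

  dg-del : ∀ x → dg tree x + (δ w x + δ w′ x) ≡ dg T x
  dg-del = count-delEdge (edges (sub T)) w w′ (edges-sym (sub T)) (E-≢ T ww′) ww′

  -- With degree at least three, `w′` does not become a leaf in place of `w`.
  leaves-del : 3 ≤ dg T w′ → suc (numLeaves tree) ≤ numLeaves T
  leaves-del d = ≤-trans (≤-reflexive (trans (+-comm 1 _) (trans (cong (numLeaves tree +_) (sym (∑-δ w)))
                                                                 (sym (∑-+ lf′ (δ w)))))) (∑-mono le)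
    where
    lf lf′ : Fin n → ℕ
    lf x  = 𝟙leaf (verts (sub T) x) (dg T x)
    lf′ x = 𝟙leaf (V′ x) (dg tree x)
    le : ∀ x → lf′ x + δ w x ≤ lf x
    le x = [ at-w″ , (λ x≢w → [ at-w′ x≢w , other x≢w ]′ (toSum (x ≟ w′))) ]′ (toSum (x ≟ w))
      where
      at-w″ : x ≡ w → lf′ x + δ w x ≤ lf x
      at-w″ refl = ≤-reflexive (trans (cong₂ _+_
        (𝟙leaf-out (dg tree x) (trans (cong (λ b → verts (sub T) x ∧ not b) (dec-true (x ≟ x) refl)) (∧-zeroʳ _)))
        (δ-refl x)) (sym (𝟙leaf-leaf T lw)))
      at-w′ : x ≢ w → x ≡ w′ → lf′ x + δ w x ≤ lf x
      at-w′ x≢w refl = ≤-trans (≤-reflexive (cong₂ _+_ (𝟙leaf-branch (V′ x) (+-cancelʳ-≤ 1 2 _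
        (≤-trans d (≤-reflexive (sym (trans (cong (dg tree x +_) (sym (cong₂ _+_ (δ-≢ x≢w) (δ-refl x)))) (dg-del x)))))))
        (δ-≢ x≢w))) z≤n
      other : x ≢ w → x ≢ w′ → lf′ x + δ w x ≤ lf x
      other x≢w x≢w′ = ≤-reflexive (trans (cong₂ _+_ (cong₂ 𝟙leaf
        (trans (cong (λ b → verts (sub T) x ∧ not b) (dec-false (x ≟ w) x≢w)) (∧-identityʳ _))
        (trans (sym (trans (cong (dg tree x +_) (cong₂ _+_ (δ-≢ x≢w) (δ-≢ x≢w′))) (+-identityʳ _))) (dg-del x)))
        (δ-≢ x≢w)) (+-identityʳ _))

-- Leaf counts under exchanges

∑-bound : ∀ {n} {f g h k : Fin n → ℕ} → (∀ v → f v + g v ≤ h v + k v) → ∑ f + ∑ g ≤ ∑ h + ∑ k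
∑-bound {f = f} {g} {h} {k} le = subst₂ _≤_ (∑-+ f g) (∑-+ h k) (∑-mono le)

leafAt : ∀ {n} {G : Graph n} → Tree G → Fin n → ℕ
leafAt T v = 𝟙leaf (verts (sub T) v) (dg T v)

-- A tree move that, in effect, hands one unit of degree from v to the leaf y.
module DegreeShift {n : ℕ} {G : Graph n} (T T′ : Tree G) (same : verts (sub T′) ≡ verts (sub T)) {v y : Fin n}
  (ly : Leaf T y) (v≢y : v ≢ y) (shift : ∀ w → dg T′ w + δ v w ≡ dg T w + δ y w) where

  dg-other : ∀ {w} → w ≢ v → w ≢ y → dg T′ w ≡ dg T w
  dg-other {w} w≢v w≢y = +-cancelʳ-≡ 0 _ _
    (trans (cong (dg T′ w +_) (sym (δ-≢ w≢v))) (trans (shift w) (cong (dg T w +_) (δ-≢ w≢y))))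

  dg-v : suc (dg T′ v) ≡ dg T v
  dg-v = trans (+-comm 1 _) (trans (cong (dg T′ v +_) (sym (δ-refl v)))
         (trans (shift v) (trans (cong (dg T v +_) (δ-≢ v≢y)) (+-identityʳ _))))

  dg-y : dg T′ y ≡ 2
  dg-y = +-cancelʳ-≡ 0 _ _ (trans (cong (dg T′ y +_) (sym (δ-≢ (v≢y ∘ sym))))
         (trans (shift y) (cong₂ _+_ (proj₂ ly) (δ-refl y))))

  dg-grow : ∀ {w} → w ≢ v → dg T w ≤ dg T′ w
  dg-grow {w} w≢v = ≤-trans (m≤m+n _ (δ y w)) (≤-reflexive
    (trans (sym (shift w)) (trans (cong (dg T′ w +_) (δ-≢ w≢v)) (+-identityʳ _))))

  verts-other : ∀ {w} → In T w → In T′ w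
  verts-other {w} = subst (λ V → V w ≡ true) (sym same)

  leaf-other : ∀ {w} → w ≢ v → Leaf T w → w ≢ y → Leaf T′ w
  leaf-other w≢v (w∈ , d) w≢y = verts-other w∈ , trans (dg-other w≢v w≢y) d

  leaf-v : In T v → dg T v ≡ 2 → Leaf T′ v
  leaf-v v∈ d = verts-other v∈ , suc-injective (trans dg-v d)

  private
    leafAt-y : leafAt T′ y + δ y y ≤ leafAt T y
    leafAt-y = ≤-reflexive (trans (cong₂ _+_ (𝟙leaf-branch (verts (sub T′) y) (≤-reflexive (sym dg-y))) (δ-refl y))
                                  (sym (𝟙leaf-leaf T ly)))

    leafAt-other : ∀ {w} → w ≢ v → w ≢ y → leafAt T′ w + δ y w ≤ leafAt T w
    leafAt-other {w} w≢v w≢y = ≤-reflexive (trans (cong₂ _+_ (cong₂ 𝟙leaf (cong (λ V → V w) same) (dg-other w≢v w≢y))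
                                                             (δ-≢ w≢y)) (+-identityʳ _))

  -- At worst `v` becomes a leaf, and `y` has ceased to be one.
  leaves-shift : numLeaves T′ ≤ numLeaves T
  leaves-shift = +-cancelʳ-≤ 1 _ _ (subst₂ (λ p q → numLeaves T′ + p ≤ numLeaves T + q) (∑-δ y) (∑-δ v)
    (∑-bound {f = leafAt T′} {δ y} {leafAt T} {δ v} le))
    where
    le : ∀ w → leafAt T′ w + δ y w ≤ leafAt T w + δ v w
    le w = [ at-v , (λ w≢v → ≤-trans ([ (λ { refl → leafAt-y }) , leafAt-other w≢v ]′ (toSum (w ≟ y))) (m≤m+n _ _)) ]′
           (toSum (w ≟ v))
      where
      at-v : w ≡ v → leafAt T′ w + δ y w ≤ leafAt T w + δ v w
      at-v refl = ≤-trans (≤-reflexive (trans (cong (leafAt T′ w +_) (δ-≢ v≢y)) (+-identityʳ _)))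
        (≤-trans (𝟙leaf≤1 (verts (sub T′) w) (dg T′ w)) (≤-trans (≤-reflexive (sym (δ-refl w))) (m≤n+m _ _)))

  leaves-shift-branch : 3 ≤ dg T v → numLeaves T′ < numLeaves T
  leaves-shift-branch d = ≤-trans (≤-reflexive (trans (+-comm 1 _) (trans (cong (numLeaves T′ +_) (sym (∑-δ y)))
    (sym (∑-+ (leafAt T′) (δ y)))))) (∑-mono le)
    where
    le : ∀ w → leafAt T′ w + δ y w ≤ leafAt T w
    le w = [ at-v , (λ w≢v → [ (λ { refl → leafAt-y }) , leafAt-other w≢v ]′ (toSum (w ≟ y))) ]′ (toSum (w ≟ v))
      where
      at-v : w ≡ v → leafAt T′ w + δ y w ≤ leafAt T w
      at-v refl = ≤-trans (≤-reflexive (cong₂ _+_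
        (𝟙leaf-branch (verts (sub T′) w) (≤-pred (≤-trans d (≤-reflexive (sym dg-v))))) (δ-≢ v≢y))) z≤n

-- Moves the subtree beyond bq, which contains the leaf y, so that it hangs by y from w.
module Rehang {n : ℕ} {G : Graph n} (T : Tree G) {b q w y : Fin n}
  (bq : E T b q) (branch : 3 ≤ dg T b) (ly : Leaf T y) (y-side : Side T b q y)
  (w∈ : In T w) (w-off : Off T b q w) (wy : Adj G w y) where

  open Exchange T {b} {q} {w} {y} bq w∈ (proj₁ ly) w-off y-side wy public

  b≢q : b ≢ q
  b≢q = E-≢ T bq

  w≢y : w ≢ y
  w≢y refl = clash y-side w-off

  w≢q : w ≢ q
  w≢q refl = clash (side-tgt T bq) w-off

  y≢b : y ≢ b
  y≢b refl = clash y-side (side-src T bq)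

  dg-other : ∀ {v} → v ≢ b → v ≢ q → dg tree v ≡ dg T v + (δ w v + δ y v)
  dg-other {v} v≢b v≢q = trans (sym (trans (cong (dg tree v +_) (cong₂ _+_ (δ-≢ v≢b) (δ-≢ v≢q))) (+-identityʳ _)))
                               (dg-exchange v)

  dg-b : dg T b ≤ suc (dg tree b)
  dg-b = begin
    dg T b                          ≤⟨ m≤m+n _ _ ⟩
    dg T b + (δ w b + δ y b)        ≡⟨ sym (dg-exchange b) ⟩
    dg tree b + (δ b b + δ q b)     ≡⟨ cong (dg tree b +_) (cong₂ _+_ (δ-refl b) (δ-≢ b≢q)) ⟩
    dg tree b + 1                   ≡⟨ +-comm _ 1 ⟩
    suc (dg tree b)                 ∎
    where open ≤-Reasoning

  dg-w : w ≢ b → dg tree w ≡ suc (dg T w)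
  dg-w w≢b = trans (dg-other w≢b w≢q) (trans (cong (dg T w +_) (cong₂ _+_ (δ-refl w) (δ-≢ w≢y))) (+-comm _ 1))

  leaf-other : ∀ {v} → v ≢ q → Leaf T v → v ≢ w → v ≢ y → Leaf tree v
  leaf-other {v} v≢q (v∈ , d) v≢w v≢y = v∈ , trans (dg-other v≢b v≢q)
    (trans (cong (dg T v +_) (cong₂ _+_ (δ-≢ v≢w) (δ-≢ v≢y))) (trans (+-identityʳ _) d))
    where
    v≢b : v ≢ b
    v≢b refl = contradiction (≤-trans branch (≤-reflexive d)) λ { (s≤s ()) }

  -- Only `q` can become a leaf, and `y` pays for it by reaching degree two; if `q` is `y`, a leaf
  -- is merely moved. The branch vertex `b` keeps degree at least two. The weight `g`, concentrated
  -- at `w`, records a further gain: it is zero in general, and one if `w` was a leaf, since the new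
  -- edge makes `w` an inner vertex.
  leaves-bound : (g : Fin n → ℕ) → g w ≤ leafAt T w → (∀ {v} → v ≢ w → g v ≡ 0) → numLeaves tree + ∑ g ≤ numLeaves T
  leaves-bound g gw g0 = +-cancelʳ-≤ 1 _ _ (begin
    numLeaves tree + ∑ g + 1         ≡⟨ cong (numLeaves tree + ∑ g +_) (sym (∑-δ y)) ⟩
    numLeaves tree + ∑ g + ∑ (δ y)   ≡⟨ cong (_+ ∑ (δ y)) (sym (∑-+ (leafAt tree) g)) ⟩
    ∑ (λ v → leafAt tree v + g v) + ∑ (δ y) ≤⟨ ∑-bound {f = λ v → leafAt tree v + g v} {δ y} {leafAt T} {δ q} le ⟩
    numLeaves T + ∑ (δ q)            ≡⟨ cong (numLeaves T +_) (∑-δ q) ⟩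
    numLeaves T + 1                  ∎)
    where
    open ≤-Reasoning
    Goal : Fin n → Set
    Goal v = leafAt tree v + g v + δ y v ≤ leafAt T v + δ q v
    at-b : Goal b
    at-b = ≤-trans (≤-reflexive (cong₂ _+_ (cong₂ _+_
      (𝟙leaf-branch (verts (sub tree) b) (≤-pred (≤-trans branch dg-b))) gb≡0) (δ-≢ (y≢b ∘ sym)))) z≤n
      where
      gb≡0 : g b ≡ 0
      gb≡0 with b ≟ w
      ... | no b≢w = g0 b≢w
      ... | yes b≡w = n≤0⇒n≡0 (subst (λ x → g x ≤ 0) (sym b≡w) (≤-trans gw (≤-reflexive
        (𝟙leaf-branch (verts (sub T) w) (≤-trans (s≤s (s≤s z≤n)) (subst (λ x → 3 ≤ dg T x) b≡w branch))))))
    at-q : Goal q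
    at-q = [ same , other ]′ (toSum (q ≟ y))
      where
      same : q ≡ y → Goal q
      same refl = ≤-trans (+-monoˡ-≤ (δ q q) (≤-trans (≤-reflexive (trans (cong (leafAt tree q +_) (g0 (w≢q ∘ sym)))
        (+-identityʳ _))) (≤-trans (𝟙leaf≤1 (verts (sub tree) q) (dg tree q)) (≤-reflexive (sym (𝟙leaf-leaf T ly)))))) ≤-refl
      other : q ≢ y → Goal q
      other q≢y = ≤-trans (≤-reflexive (trans (cong₂ _+_ (trans (cong (leafAt tree q +_) (g0 (w≢q ∘ sym)))
        (+-identityʳ _)) (δ-≢ q≢y)) (+-identityʳ _)))
        (≤-trans (𝟙leaf≤1 (verts (sub tree) q) (dg tree q)) (≤-trans (≤-reflexive (sym (δ-refl q))) (m≤n+m _ _)))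
    at-y : y ≢ q → Goal y
    at-y y≢q = ≤-trans (≤-reflexive (trans (cong₂ _+_ (cong₂ _+_ (𝟙leaf-branch (verts (sub tree) y) 2≤dg)
      (g0 (w≢y ∘ sym))) (δ-refl y)) (sym (𝟙leaf-leaf T ly)))) (m≤m+n _ _)
      where
      2≤dg : 2 ≤ dg tree y
      2≤dg = ≤-reflexive (sym (trans (dg-other y≢b y≢q)
        (cong₂ _+_ (proj₂ ly) (cong₂ _+_ (δ-≢ (w≢y ∘ sym)) (δ-refl y)))))
    at-w : w ≢ b → Goal w
    at-w w≢b = ≤-trans (≤-reflexive (trans (cong₂ _+_ (cong (_+ g w) (𝟙leaf-branch (verts (sub tree) w) 2≤dg))
      (δ-≢ w≢y)) (+-identityʳ _))) (≤-trans gw (m≤m+n _ _))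
      where
      2≤dg : 2 ≤ dg tree w
      2≤dg = ≤-trans (s≤s (pos-degree T w∈ (proj₁ ly) w≢y)) (≤-reflexive (sym (dg-w w≢b)))
    at-other : ∀ {v} → v ≢ b → v ≢ q → v ≢ y → v ≢ w → Goal v
    at-other {v} v≢b v≢q v≢y v≢w = ≤-reflexive (trans (cong₂ _+_ (cong₂ _+_ (cong (𝟙leaf (verts (sub T) v))
      (trans (dg-other v≢b v≢q) (trans (cong (dg T v +_) (cong₂ _+_ (δ-≢ v≢w) (δ-≢ v≢y))) (+-identityʳ _))))
      (g0 v≢w)) (trans (δ-≢ v≢y) (sym (δ-≢ v≢q)))) (cong (_+ δ q v) (+-identityʳ _)))
    le : ∀ v → Goal v
    le v = [ (λ { refl → at-b }) , (λ v≢b →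
           [ (λ { refl → at-q }) , (λ v≢q →
           [ (λ { refl → at-y v≢q }) , (λ v≢y →
           [ (λ { refl → at-w v≢b }) , at-other v≢b v≢q v≢y ]′ (toSum (v ≟ w))) ]′ (toSum (v ≟ y))) ]′
           (toSum (v ≟ q))) ]′ (toSum (v ≟ b))

  leaves-rehang : numLeaves tree ≤ numLeaves T
  leaves-rehang = ≤-trans (≤-reflexive (sym (trans (cong (numLeaves tree +_) (∑-0 n)) (+-identityʳ _))))
                          (leaves-bound (λ _ → 0) z≤n (λ _ → refl))

  leaves-rehang-leaf : Leaf T w → numLeaves tree < numLeaves T
  leaves-rehang-leaf lw = ≤-trans (≤-reflexive (trans (+-comm 1 _) (cong (numLeaves tree +_) (sym (∑-δ w)))))
    (leaves-bound (δ w) (≤-reflexive (trans (δ-refl w) (sym (𝟙leaf-leaf T lw)))) δ-≢)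

-- Replaces the edge uv of the path from u to the leaf y by the edge uy.
module Rotate {n : ℕ} {G : Graph n} (T : Tree G) {u v y : Fin n}
  (uv : E T u v) (ly : Leaf T y) (y-side : Side T u v y) (v≢y : v ≢ y) (uy : Adj G u y) where

  open Exchange T {u} {v} {u} {y} uv (E-src T uv) (proj₁ ly) (side-src T uv) y-side uy public

  open DegreeShift T tree refl ly v≢y (λ w → +-cancelʳ-≡ (δ u w) _ _ (trans (xy∙z≈x∙zy (dg tree w) _ _)
    (trans (dg-exchange w) (x∙yz≈xz∙y (dg T w) _ _)))) public

-- Detaches the leaf z from its neighbour z′ and subdivides the edge uv with it.
module Insert {n : ℕ} {G : Graph n} (T : Tree G) {z z′ u v : Fin n}
  (lz : Leaf T z) (z′z : E T z′ z) (uv : E T u v) (u≢z : u ≢ z) (v≢z : v ≢ z) (uz : Adj G u z) (zv : Adj G z v) where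

  private
    u-off : Off T z′ z u
    u-off with true⊎false (side T z′ z u)
    ... | inj₁ s = contradiction (side-leaf T z′z (proj₂ lz) (E-src T uv) s) u≢z
    ... | inj₂ o = o

    -- First `z` is hung as a leaf from `u`; then `uv` is exchanged for the edge from `z` to `v`.
    module X₁ = Exchange T {z′} {z} {u} {z} z′z (E-src T uv) (proj₁ lz) u-off (side-tgt T z′z) uz

    uv₁ : E X₁.tree u v
    uv₁ = X₁.kept uv λ { (inj₁ (_ , p)) → v≢z p ; (inj₂ (p , _)) → u≢z p }

    z-off : Off X₁.tree u v z
    z-off with true⊎false (side X₁.tree u v z)
    ... | inj₁ s = contradiction (sym (proj₂ (side-cross X₁.tree uv₁ X₁.new (side-src X₁.tree uv₁) s))) v≢z
    ... | inj₂ o = o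

    module X₂ = Exchange X₁.tree {u} {v} {z} {v} uv₁ (proj₁ lz) (E-tgt T uv) z-off (side-tgt X₁.tree uv₁) zv

  open X₂ using (tree) public

  E⁻ : ∀ {x y} → E tree x y → (E T x y × ¬ Joins z′ z x y) ⊎ Joins u z x y ⊎ Joins z v x y
  E⁻ p with X₂.E⁻ p
  ... | inj₂ j = inj₂ (inj₂ j)
  ... | inj₁ (q , _) with X₁.E⁻ q
  ... | inj₁ r = inj₁ r
  ... | inj₂ j = inj₂ (inj₁ j)

  kept : ∀ {x y} → E T x y → ¬ Joins z′ z x y → ¬ Joins u v x y → E tree x y
  kept p i j = X₂.kept (X₁.kept p i) j

  shift : ∀ w → dg tree w + δ z′ w ≡ dg T w + δ z w
  shift w = +-cancelʳ-≡ (δ u w + δ v w) _ _ (begin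
    dg tree w + δ z′ w + (δ u w + δ v w)    ≡⟨ xy∙z≈xz∙y (dg tree w) _ _ ⟩
    dg tree w + (δ u w + δ v w) + δ z′ w    ≡⟨ cong (_+ δ z′ w) (X₂.dg-exchange w) ⟩
    dg X₁.tree w + (δ z w + δ v w) + δ z′ w ≡⟨ solve 4 (λ a b c d → a :+ (b :+ c) :+ d := a :+ (d :+ b) :+ c)
                                                 refl (dg X₁.tree w) (δ z w) (δ v w) (δ z′ w) ⟩
    dg X₁.tree w + (δ z′ w + δ z w) + δ v w ≡⟨ cong (_+ δ v w) (X₁.dg-exchange w) ⟩
    dg T w + (δ u w + δ z w) + δ v w        ≡⟨ solve 4 (λ a b c d → a :+ (b :+ c) :+ d := a :+ c :+ (b :+ d))
                                                 refl (dg T w) (δ u w) (δ z w) (δ v w) ⟩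
    dg T w + δ z w + (δ u w + δ v w) ∎)
    where
    open ≡-Reasoning
    open +-*-Solver

  open DegreeShift T tree refl lz (E-≢ T z′z) shift public using (dg-grow; leaves-shift)

-- Configurations excluded from optimal trees

module _ {n : ℕ} {G : Graph n} (T : Tree G) where

  -- The third leaf guarantees a branch vertex, which a path would not have: seen from `o`, both `x`
  -- and `y` lie beyond its only edge, and the ways to them part somewhere.
  separate : ∀ {x y o} → Leaf T x → Leaf T y → Leaf T o → x ≢ y → o ≢ x → o ≢ y →
             ∃ λ b → ∃ λ q → E T b q × 3 ≤ dg T b × Side T b q y × Off T b q x
  separate lx ly lo x≢y o≢x o≢y with o′ , oo′ , sx ← toward T (proj₁ lo) (proj₁ lx) o≢x =
    branch-between T oo′ ly lx (x≢y ∘ sym) (Off-leaf T lo oo′ (proj₁ ly) (o≢y ∘ sym)) sx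

  through : ∀ {u v y} → E T u v → In T y → Side T u v y → v ≢ y → dg T v ≡ 2 ⊎ 3 ≤ dg T v
  through {v = v} uv y∈ sy v≢y with 3 ≤? dg T v
  ... | yes d = inj₂ d
  ... | no ¬d = inj₁ (≤-antisym (≤-pred (≰⇒> ¬d))
    (≤∧≢⇒< (dg≥1 T (E-sym T uv)) λ d → v≢y (sym (side-leaf T uv (sym d) y∈ sy))))

  leaf-≢ : ∀ {x v} → Leaf T x → dg T v ≡ 2 → x ≢ v
  leaf-≢ (_ , d) d′ refl with () ← trans (sym d) d′

-- The edge `ef` outside `V` is shifted along the path towards `r` until its front end is next to a
-- vertex of `V`.
escape : ∀ {n} {G : Graph n} {V : Fin n → Bool} {e f r : Fin n} → Star (Adj G) e r → V e ≡ false → V f ≡ false →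
         Adj G e f → V r ≡ true → ∃ λ a → ∃ λ b → ∃ λ c → V a ≡ true × V b ≡ false × V c ≡ false × Adj G a b × Adj G b c
escape ε e∉ _ _ r∈ = clash r∈ e∉
escape {G = G} {V} {e} {f} (_◅_ {j = e′} ee′ path) e∉ f∉ ef r∈ with true⊎false (V e′)
... | inj₁ e′∈ = e′ , e , f , e′∈ , e∉ , f∉ , trans (adj-sym G e′ e) ee′ , ef
... | inj₂ e′∉ = escape {G = G} {V} path e′∉ e∉ (trans (adj-sym G e′ e) ee′) r∈

-- R is the conclusion of the theorem: contradictions are stated as constructions of an element of R, since the
-- existence of a dominating k-ended tree is not known to be decidable at this point.
module Optimal {n : ℕ} {G : Graph n} (connected : ∀ x y → Star (Adj G) x y) (k : ℕ) (2≤k : 2 ≤ k) {R : Set} (N : ℕ)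
  (dominating : ∀ (T : Tree G) → numLeaves T ≤ k → Dominating (sub T) → R)
  (larger : ∀ (T : Tree G) → numLeaves T ≤ suc k → N < size T → R) where

  record Opt (T : Tree G) : Set where
    constructor _,_
    field
      size-N : size T ≡ N
      leaves-k : numLeaves T ≤ suc k
  open Opt public

  private
    Adj-sym : ∀ {x y} → Adj G x y → Adj G y x
    Adj-sym {x} {y} p = trans (adj-sym G y x) p

    Adj-≢ : ∀ {x y} → Adj G x y → x ≢ y
    Adj-≢ {x} p refl = clash p (adj-irrefl G x)

  -- If T does not dominate, an edge outside it yields a pendant path with two new vertices. A tree
  -- with an edge pays at most one leaf for it; a single vertex ends up with at most two leaves.
  -- Since two vertices are gained, T may be one vertex short of `N`, which leaves room for deleting
  -- a leaf beforehand.
  extend-twice : ∀ T → numLeaves T ≤ k → N ≤ suc (size T) → R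
  extend-twice T few big with any? (λ e → any? (λ f →
    (verts (sub T) e ≟ᵇ false) ×-dec (verts (sub T) f ≟ᵇ false) ×-dec (adj G e f ≟ᵇ true)))
  ... | no ¬p = dominating T few dom
    where
    dom : Dominating (sub T)
    dom e f e∉ f∉ with true⊎false (adj G e f)
    ... | inj₁ ef = contradiction (e , f , e∉ , f∉ , ef) ¬p
    ... | inj₂ o  = o
  ... | yes (e , f , e∉ , f∉ , ef)
    with a , b , c , a∈ , b∉ , c∉ , ab , bc ←
      escape {G = G} {verts (sub T)} (connected e (proj₁ (base T))) e∉ f∉ ef (proj₂ (base T))
    = larger A₂.tree (≤-trans (A₂.leaves-leaf A₁.new-leaf) leaves₁)
        (≤-trans (s≤s big) (≤-reflexive (sym (trans A₂.size-add (cong suc A₁.size-add)))))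
    where
    module A₁ = AddLeaf T a∈ b∉ ab
    c∉₁ : verts (sub A₁.tree) c ≡ false
    c∉₁ = cong₂ _∨_ c∉ (dec-false (c ≟ b) λ { refl → Adj-≢ bc refl })
    module A₂ = AddLeaf A₁.tree A₁.v∈′ c∉₁ bc
    leaves₁ : numLeaves A₁.tree ≤ suc k
    leaves₁ with dg T a ≟ℕ 0
    ... | yes d = ≤-trans (A₁.leaves-isolated d) (≤-trans 2≤k (n≤1+n k))
    ... | no ¬d = ≤-trans (A₁.leaves-add (n≢0⇒n>0 ¬d)) (s≤s few)

  few-leaves : ∀ {T} → Opt T → numLeaves T ≤ k → R
  few-leaves {T} (sz , _) few = extend-twice T few (≤-trans (≤-reflexive (sym sz)) (n≤1+n _))

  -- Deleting `w` costs one vertex and one leaf, and `extend-twice` more than recovers the vertex.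
  branch-at-leaf : ∀ {T w w′} → Opt T → Leaf T w → E T w w′ → 3 ≤ dg T w′ → R
  branch-at-leaf {T} (sz , lv) lw ww′ d =
    extend-twice D.tree (≤-pred (≤-trans (D.leaves-del d) lv)) (≤-reflexive (trans (sym sz) (sym D.size-del)))
    where module D = DelLeaf T lw ww′

  leaf-escapes : ∀ {T x u} → Opt T → Leaf T x → Adj G x u → verts (sub T) u ≡ false → R
  leaf-escapes {T} (sz , lv) lx xu u∉ =
    larger A.tree (≤-trans (A.leaves-leaf lx) lv) (≤-reflexive (trans (cong suc (sym sz)) (sym A.size-add)))
    where module A = AddLeaf T (proj₁ lx) u∉ xu

  -- Rehanging the part that contains `y` from the leaf `x` lowers the number of leaves, because `x`
  -- becomes an inner vertex.
  adjacent-leaves : ∀ {T x y o} → Opt T → Leaf T x → Leaf T y → Leaf T o → o ≢ x → o ≢ y → Adj G x y → R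
  adjacent-leaves {T} (sz , lv) lx ly lo o≢x o≢y xy
    with b , q , bq , branch , sy , ox ← separate T lx ly lo (Adj-≢ xy) o≢x o≢y =
    few-leaves {H.tree} (sz , <⇒≤ (≤-trans H.fewer lv)) (≤-pred (≤-trans H.fewer lv))
    where
    module H where
      open Rehang T bq branch ly sy (proj₁ lx) ox xy public
      fewer : numLeaves tree < numLeaves T
      fewer = leaves-rehang-leaf lx

  -- Rehanging the part that contains `y` from `w′` raises the degree of `w′` to at least three
  -- while `w` stays a leaf there, the situation of `branch-at-leaf`.
  leaf-nbr-nonadjacent : ∀ {T y w o w′} → Opt T → Leaf T y → Leaf T w → Leaf T o → y ≢ w → o ≢ y → o ≢ w →
                         E T w w′ → Adj G y w′ → R
  leaf-nbr-nonadjacent {T} {y} {w} {o} {w′} (sz , lv) ly lw lo y≢w o≢y o≢w ww′ yw′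
    with 3 ≤? dg T w′ | separate T lw ly lo (y≢w ∘ sym) o≢w o≢y
  ... | yes d | _ = branch-at-leaf {T} (sz , lv) lw ww′ d
  ... | no ¬d | b , q , bq , branch , sy , ow = branch-at-leaf {H.tree} (sz , ≤-trans H.leaves-rehang lv) lw′ ww″ d′
    where
    w≢b : w ≢ b
    w≢b refl = contradiction (≤-trans branch (≤-reflexive (proj₂ lw))) λ { (s≤s ()) }
    w≢q : w ≢ q
    w≢q refl = clash (side-tgt T bq) ow
    off : Off T b q w′
    off with true⊎false (side T b q w′)
    ... | inj₁ s = contradiction (proj₁ (side-cross T bq ww′ ow s)) w≢b
    ... | inj₂ p = p
    module H = Rehang T bq branch ly sy (E-tgt T ww′) off (Adj-sym yw′)
    lw′ : Leaf H.tree w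
    lw′ = H.leaf-other w≢q lw (E-≢ T ww′) (y≢w ∘ sym)
    ww″ : E H.tree w w′
    ww″ = H.kept ww′ λ { (inj₁ (p , _)) → w≢b p ; (inj₂ (p , _)) → w≢q p }
    dg≢1 : dg T w′ ≢ 1
    dg≢1 d = Adj-≢ yw′ (side-leaf T ww′ d (proj₁ ly) (Off-leaf T lw ww′ (proj₁ ly) y≢w))
    d′ : 3 ≤ dg H.tree w′
    d′ = ≤-trans (s≤s (≤∧≢⇒< (dg≥1 T (E-sym T ww′)) (dg≢1 ∘ sym)))
                 (≤-reflexive (sym (H.dg-w λ { refl → ¬d branch })))

  module _ {T : Tree G} (opt : Opt T) {u v y : Fin n}
    (uv : E T u v) (ly : Leaf T y) (sy : Side T u v y) (yu : Adj G y u) where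

    private module Rot (v≢y : v ≢ y) = Rotate T uv ly sy v≢y (Adj-sym yu)

    rotate-branch : v ≢ y → 3 ≤ dg T v → R
    rotate-branch v≢y d = few-leaves {tree} (size-N opt , ≤-trans leaves-shift (leaves-k opt))
                                     (≤-pred (≤-trans (leaves-shift-branch d) (leaves-k opt)))
      where open Rot v≢y

    -- After the rotation `v` is a leaf in place of `y`, or is `y` already, so an edge from `x` to
    -- `v` joins two leaves.
    rotate-adjacent : ∀ {x o} → Leaf T x → Leaf T o → x ≢ y → o ≢ y → o ≢ x → Adj G x v → R
    rotate-adjacent {x} {o} lx lo x≢y o≢y o≢x xv with v ≟ y
    ... | yes refl = adjacent-leaves {T} opt lx ly lo o≢x o≢y xv
    ... | no v≢y with through T uv (proj₁ ly) sy v≢y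
    ... | inj₂ d = rotate-branch v≢y d
    ... | inj₁ d = adjacent-leaves {tree} (size-N opt , ≤-trans leaves-shift (leaves-k opt))
        (leaf-other (leaf-≢ T lx d) lx x≢y) (leaf-v (E-tgt T uv) d) (leaf-other (leaf-≢ T lo d) lo o≢y)
        o≢x (leaf-≢ T lo d) xv
      where open Rot v≢y

    module _ (v≢y : v ≢ y) {r : Fin n} (vr : E T v r) (sr : Side T v r y) where
      private
        ¬joins : ¬ Joins u v v r
        ¬joins (inj₁ (p , _)) = E-≢ T uv (sym p)
        ¬joins (inj₂ (_ , refl)) = clash sr (Side⇒Off T uv (proj₁ ly) sy)

      -- The rotation makes `v` a leaf that hangs from `r`; thus `r` inherits what is known about
      -- neighbours of leaves. The same idea gives `next-adjacent`.
      next-branch : 3 ≤ dg T r → R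
      next-branch dr with through T uv (proj₁ ly) sy v≢y
      ... | inj₂ d = rotate-branch v≢y d
      ... | inj₁ d = branch-at-leaf {tree} (size-N opt , ≤-trans leaves-shift (leaves-k opt))
          (leaf-v (E-tgt T uv) d) (kept vr ¬joins) (≤-trans dr (dg-grow (E-≢ T vr ∘ sym)))
        where open Rot v≢y

      next-adjacent : ∀ {x o} → Leaf T x → Leaf T o → x ≢ y → o ≢ y → o ≢ x → Adj G x r → R
      next-adjacent {x} {o} lx lo x≢y o≢y o≢x xr with through T uv (proj₁ ly) sy v≢y
      ... | inj₂ d = rotate-branch v≢y d
      ... | inj₁ d = leaf-nbr-nonadjacent {tree} (size-N opt , ≤-trans leaves-shift (leaves-k opt))
          (leaf-other (leaf-≢ T lx d) lx x≢y) (leaf-v (E-tgt T uv) d) (leaf-other (leaf-≢ T lo d) lo o≢y)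
          (leaf-≢ T lx d) o≢x (leaf-≢ T lo d) (kept vr ¬joins) xr
        where open Rot v≢y

  module Minimal {T : Tree G} (opt : Opt T) {b q : Fin n} (bq : E T b q) (branch : 3 ≤ dg T b)
    (smaller : ∀ {T′ b′ q′} → Opt T′ → E T′ b′ q′ → 3 ≤ dg T′ b′ → sideSize T′ b′ q′ < sideSize T b q → R) where

    -- Hanging the subtree of y from u would leave a smaller subtree beyond an edge at u.
    side-nonadjacent : ∀ {a x y u} → E T b a → a ≢ q → Leaf T y → Side T b a y → Leaf T x → Off T b q x → x ≢ y →
                       In T u → Side T b q u → Adj G y u → R
    side-nonadjacent {a} {x} {y} {u} ba a≢q ly sy lx ox x≢y u∈ su yu with dg T u ≟ℕ 1
    ... | yes d = adjacent-leaves {T} opt ly (u∈ , d) lx x≢y (λ { refl → clash su ox }) yu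
    ... | no ¬d = with-next (toward T u∈ (E-src T bq) u≢b)
      where
      u≢b : u ≢ b
      u≢b refl = clash su (side-src T bq)
      off : Off T b a u
      off with true⊎false (side T b a u)
      ... | inj₁ s = contradiction (toward-unique T ba bq u∈ s su) a≢q
      ... | inj₂ o = o
      module H = Rehang T ba branch ly sy u∈ off (Adj-sym yu)
      1≤dg : 1 ≤ dg T u
      1≤dg = pos-degree T u∈ (E-src T bq) u≢b
      descend : ∀ {u⁺} → E T u u⁺ → Off T u u⁺ b → R
      descend {u⁺} uu⁺ ob = smaller {H.tree} (size-N opt , ≤-trans H.leaves-rehang (leaves-k opt)) uu′
        (≤-trans (s≤s (≤∧≢⇒< 1≤dg (¬d ∘ sym))) (≤-reflexive (sym (H.dg-w u≢b))))
        (count-drop shrink (∧-intro u∈ su))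
        where
        uu′ : E H.tree u u⁺
        uu′ = H.kept uu⁺ λ { (inj₁ (p , _)) → u≢b p ; (inj₂ (refl , _)) → clash (side-tgt T ba) off }
        su⁺ : Side T b q u⁺
        su⁺ with true⊎false (side T b q u⁺)
        ... | inj₁ s = s
        ... | inj₂ o with refl , refl ← side-cross T bq (E-sym T uu⁺) o su = clash (side-tgt T uu⁺) ob
        -- The edge added by the rehanging ends at `u`, which is not beyond `uu⁺`; so nothing new
        -- can be reached there.
        closed : ∀ {e f} → E H.tree e f → Side H.tree u u⁺ e → Side H.tree u u⁺ f → Side T u u⁺ e → Side T u u⁺ f
        closed {e} {f} ef se sf s with H.E⁻ ef
        ... | inj₂ (inj₁ (refl , _)) = clash se (side-src H.tree uu′)
        ... | inj₂ (inj₂ (_ , refl)) = clash sf (side-src H.tree uu′)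
        ... | inj₁ (ef₀ , _) with true⊎false (side T u u⁺ f)
        ... | inj₁ t = t
        ... | inj₂ t with refl , refl ← side-cross T uu⁺ (E-sym T ef₀) t s = clash sf (side-src H.tree uu′)
        shrink : ∀ w → inSide H.tree u u⁺ w ≡ true → inSide T b q w ≡ true × w ≢ u
        shrink w p = ∧-intro w∈ (side-nested T uu⁺ bq ob (side-tgt T uu⁺) (E-tgt T uu⁺) su⁺ w∈
                       (side-⊆ H.tree uu′ (side-tgt T uu⁺) closed w∈ s))
                   , λ { refl → clash s (side-src H.tree uu′) }
          where
          w∈ = ∧-left p
          s = ∧-right {verts (sub T) w} p
      with-next : (∃ λ u⁻ → E T u u⁻ × Side T u u⁻ b) → R
      with-next (u⁻ , uu⁻ , sb)
        -- Since `u` is no leaf, it has a neighbour away from `b`. Beyond the edge to it lies a part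
        -- of the old side of `bq` that misses `u`.
        with u⁺ , uu⁺ , u⁺≢u⁻ ← pick₂ (edges (sub T) u) (≤∧≢⇒< 1≤dg (¬d ∘ sym)) u⁻
        with true⊎false (side T u u⁺ b)
      ... | inj₁ s = contradiction (toward-unique T uu⁺ uu⁻ (E-src T bq) s sb) u⁺≢u⁻
      ... | inj₂ o = descend uu⁺ o

    -- Subdividing uv by z would leave a smaller subtree beyond bq.
    no-insertion : ∀ {z u v} → Leaf T z → Side T b q z → E T u v → Off T b q u → Off T b q v →
                   Adj G z u → Adj G z v → R
    no-insertion {z} {u} {v} lz sz uv ou ov zu zv with q ≟ z
    ... | yes refl = branch-at-leaf {T} opt lz (E-sym T bq) branch
    ... | no q≢z = with-nbr (toward T (proj₁ lz) (E-src T bq) z≢b)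
      where
      z≢b : z ≢ b
      z≢b refl = clash sz (side-src T bq)
      u≢z : u ≢ z
      u≢z refl = clash sz ou
      v≢z : v ≢ z
      v≢z refl = clash sz ov
      with-nbr : (∃ λ z′ → E T z z′ × Side T z z′ b) → R
      with-nbr (z′ , zz′ , _) = smaller {I.tree} (size-N opt , ≤-trans I.leaves-shift (leaves-k opt)) bq′
        (≤-trans branch (I.dg-grow b≢z′)) (count-drop shrink (∧-intro (proj₁ lz) sz))
        where
        module I = Insert T lz (E-sym T zz′) uv u≢z v≢z (Adj-sym zu) zv
        b≢z′ : b ≢ z′
        -- The vertex `z′` loses a neighbour, so `b` must be a different vertex in order to remain a
        -- branch vertex.
        b≢z′ refl = q≢z (toward-unique T bq (E-sym T zz′) (proj₁ lz) sz (side-tgt T (E-sym T zz′)))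
        bq′ : E I.tree b q
        bq′ = I.kept bq (λ { (inj₁ (_ , p)) → q≢z p ; (inj₂ (p , _)) → z≢b (sym p) })
                        (λ { (inj₁ (_ , refl)) → clash (side-tgt T bq) ov ; (inj₂ (_ , refl)) → clash (side-tgt T bq) ou })
        P : Fin n → Set
        P w = Side T b q w × w ≢ z
        closed : ∀ {e f} → E I.tree e f → Side I.tree b q e → Side I.tree b q f → P e → P f
        closed {e} {f} ef _ sf (s , e≢z) with I.E⁻ ef
        ... | inj₂ (inj₁ (inj₁ (refl , _))) = clash s ou
        ... | inj₂ (inj₁ (inj₂ (p , _))) = contradiction p e≢z
        ... | inj₂ (inj₂ (inj₁ (p , _))) = contradiction p e≢z
        ... | inj₂ (inj₂ (inj₂ (refl , _))) = clash s ov
        ... | inj₁ (ef₀ , ¬j) with true⊎false (side T b q f)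
        ... | inj₁ t = t , λ { refl → ¬j (inj₁ (leaf-nbr T (proj₂ lz) (E-sym T ef₀) zz′ , refl)) }
        ... | inj₂ t with refl , refl ← side-cross T bq (E-sym T ef₀) t s = clash sf (side-src I.tree bq′)
        shrink : ∀ w → inSide I.tree b q w ≡ true → inSide T b q w ≡ true × w ≢ z
        shrink w p = let (s , w≢z) = side-⊆ I.tree {P = P} bq′ (side-tgt T bq , q≢z) closed (∧-left p)
                                            (∧-right {verts (sub T) w} p)
                     in ∧-intro (∧-left p) s , w≢z

-- Counting at an optimal tree

module _ {A B : Set} where

  sum-swap : (g : A → B → ℕ) → ∀ xs ys →
             sum (map (λ u → sum (map (g u) ys)) xs) ≡ sum (map (λ v → sum (map (λ u → g u v) xs)) ys)
  sum-swap g [] ys = zeros ys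
    where
    zeros : ∀ ys → 0 ≡ sum (map (λ _ → 0) ys)
    zeros [] = refl
    zeros (_ ∷ ys) = zeros ys
  sum-swap g (x ∷ xs) ys = trans (cong (sum (map (g x) ys) +_) (sum-swap g xs ys))
    (sym (sum-+ (g x) (λ v → sum (map (λ u → g u v) xs)) ys))

module _ {n : ℕ} where

  image : (Fin n → Fin n) → (Fin n → Bool) → Fin n → Bool
  image f P v = does (any? λ u → (P u ≟ᵇ true) ×-dec (f u ≟ v))

  image⁻ : ∀ f P {v} → image f P v ≡ true → ∃ λ u → P u ≡ true × f u ≡ v
  image⁻ f P {v} = witness (any? λ u → (P u ≟ᵇ true) ×-dec (f u ≟ v))

  image⁺ : ∀ f P {u} → P u ≡ true → image f P (f u) ≡ true
  image⁺ f P {u} p = dec-true (any? λ w → (P w ≟ᵇ true) ×-dec (f w ≟ f u)) (u , p , refl)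

  -- Double counting of the pairs `(u , f u)`: each row of a member of `P` has sum one, and
  -- injectivity bounds each column by one.
  count-image : ∀ (f : Fin n → Fin n) (P : Fin n → Bool) →
                (∀ {u v} → P u ≡ true → P v ≡ true → f u ≡ f v → u ≡ v) → count P ≤ count (image f P)
  count-image f P inj = begin
    count P                        ≡⟨ ∑-cong (λ u → sym (row u)) ⟩
    ∑ (λ u → ∑ (g u))              ≡⟨ sum-swap g (allFin n) (allFin n) ⟩
    ∑ (λ v → ∑ (λ u → g u v))      ≤⟨ ∑-mono column ⟩
    count (image f P)              ∎
    where
    open ≤-Reasoning
    g : Fin n → Fin n → ℕ
    g u v = if P u then δ (f u) v else 0
    row : ∀ u → ∑ (g u) ≡ 𝟙 (P u)
    row u with P u
    ... | true  = ∑-δ (f u)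
    ... | false = ∑-0 n
    column : ∀ v → ∑ (λ u → g u v) ≤ 𝟙 (image f P v)
    column v with true⊎false (image f P v)
    ... | inj₁ im with u₀ , p₀ , refl ← image⁻ f P im =
      ≤-trans (∑-mono le) (≤-reflexive (trans (∑-δ u₀) (sym (𝟙-true im))))
      where
      le : ∀ u → g u (f u₀) ≤ δ u₀ u
      le u with P u in pu
      ... | false = z≤n
      ... | true with f u₀ ≟ f u
      ... | no _   = z≤n
      ... | yes eq = ≤-reflexive (sym (trans (cong (δ u₀) (inj pu p₀ (sym eq))) (δ-refl u₀)))
    ... | inj₂ im = ≤-trans (∑-mono le) (≤-trans (≤-reflexive (∑-0 n)) z≤n)
      where
      le : ∀ u → g u v ≤ 0
      le u with P u in pu
      ... | false = z≤n
      ... | true  = ≤-reflexive (δ-≢ {u = v} {f u} λ { refl → clash (image⁺ f P pu) im })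

  count-disjoint : (P Q : Fin n → Bool) → (∀ {u} → P u ≡ true → Q u ≡ true → ⊥) →
                   count P + count Q ≤ count (λ u → P u ∨ Q u)
  count-disjoint P Q dis = ≤-trans (≤-reflexive (sym (∑-+ (𝟙 ∘ P) (𝟙 ∘ Q)))) (∑-mono le)
    where
    le : ∀ u → 𝟙 (P u) + 𝟙 (Q u) ≤ 𝟙 (P u ∨ Q u)
    le u with P u in p | Q u in q
    ... | true  | true  = ⊥-elim (dis p q)
    ... | true  | false = ≤-refl
    ... | false | _     = ≤-refl

  count-∧-∨ : (P Q : Fin n → Bool) → count P + count Q ≤ count (λ u → P u ∧ Q u) + count (λ u → P u ∨ Q u)
  count-∧-∨ P Q = ∑-bound {f = 𝟙 ∘ P} {𝟙 ∘ Q} le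
    where
    le : ∀ u → 𝟙 (P u) + 𝟙 (Q u) ≤ 𝟙 (P u ∧ Q u) + 𝟙 (P u ∨ Q u)
    le u with P u | Q u
    ... | true  | true  = ≤-refl
    ... | true  | false = ≤-refl
    ... | false | _     = ≤-refl

∨-elim : ∀ {a b} → a ∨ b ≡ true → a ≡ true ⊎ b ≡ true
∨-elim {true}  _ = inj₁ refl
∨-elim {false} p = inj₂ p

not-does : {A : Set} (a? : Dec A) → not (does a?) ≡ true → ¬ A
not-does a? p = refutation a? (not-true p)

-- If every violation of a decidable condition yields `R`, the condition may be assumed to hold
-- throughout.
search : ∀ {n} {R : Set} {P : Fin n → Set} → (∀ u → Dec (P u)) → (∀ u → P u → R) → ((∀ u → ¬ P u) → R) → R
search P? found absent with any? P?
... | yes (u , p) = found u p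
... | no ¬p = absent λ u p → ¬p (u , p)

-- The tree rooted at a leaf

module Rooted {n : ℕ} {G : Graph n} (T : Tree G) {x : Fin n} (lx : Leaf T x) where

  private
    next? : ∀ u v → Dec (E T u v × Side T u v x)
    next? u v = (edges (sub T) u v ≟ᵇ true) ×-dec (side T u v x ≟ᵇ true)

  -- Junk value u when u is the root x or lies outside T.
  parent : Fin n → Fin n
  parent u with any? (next? u)
  ... | yes (v , _) = v
  ... | no _ = u

  parent-spec : ∀ {u} → In T u → u ≢ x → E T u (parent u) × Side T u (parent u) x
  parent-spec {u} u∈ u≢x with any? (next? u)
  ... | yes (_ , p) = p
  ... | no ¬p = contradiction (toward T u∈ (proj₁ lx) u≢x) ¬p

  parent-not-leaf : ∀ {u} → In T u → u ≢ x → Leaf T (parent u) → parent u ≡ x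
  parent-not-leaf {u} u∈ u≢x lw with parent u ≟ x
  ... | yes p = p
  ... | no w≢x =
    let (uw , sw) = parent-spec u∈ u≢x
        (v , wv , sv) = toward T (proj₁ lw) (proj₁ lx) w≢x
    in clash (subst (λ a → Side T (parent u) a x) (leaf-nbr T (proj₂ lw) wv (E-sym T uw)) sv)
             (Side⇒Off T uw (proj₁ lx) sw)

  -- Two children and the next vertex towards the root are three neighbours. The root itself, being
  -- a leaf, has only one child.
  siblings-branch : ∀ {u v} → In T u → In T v → u ≢ x → v ≢ x → parent u ≡ parent v → u ≢ v → 3 ≤ dg T (parent u)
  siblings-branch {u} {v} u∈ v∈ u≢x v≢x eq u≢v
    with uw , su ← parent-spec u∈ u≢x | vw′ , sv′ ← parent-spec v∈ v≢x
    with parent u ≟ x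
  ... | yes p = contradiction (leaf-nbr T (proj₂ lx) (subst (λ a → E T a u) p (E-sym T uw))
                                (subst (λ a → E T a v) (trans (sym eq) p) (E-sym T vw′))) u≢v
  ... | no w≢x
    with vw ← subst (E T v) (sym eq) vw′ | sv ← subst (λ a → Side T v a x) (sym eq) sv′
    with r , wr , sr ← toward T (E-tgt T uw) (proj₁ lx) w≢x =
    3≤count (edges (sub T) (parent u)) (E-sym T uw) (E-sym T vw) wr (u≢v ∘ sym)
      (λ { refl → clash sr (Side⇒Off T uw (proj₁ lx) su) }) (λ { refl → clash sr (Side⇒Off T vw (proj₁ lx) sv) })

-- Three leaves around a branch vertex

module Configuration {n : ℕ} {G : Graph n} (connected : ∀ x y → Star (Adj G) x y) (k : ℕ) (2≤k : 2 ≤ k) {R : Set} (N : ℕ)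
  (dominating : ∀ (T : Tree G) → numLeaves T ≤ k → Dominating (sub T) → R)
  (larger : ∀ (T : Tree G) → numLeaves T ≤ suc k → N < size T → R) where

  open Optimal connected k 2≤k N dominating larger

  module _ {T : Tree G} (opt : Opt T) (many : suc k ≤ numLeaves T) {b q : Fin n} (bq : E T b q) (branch : 3 ≤ dg T b)
    (smaller : ∀ {T′ b′ q′} → Opt T′ → E T′ b′ q′ → 3 ≤ dg T′ b′ → sideSize T′ b′ q′ < sideSize T b q → R)
    {a₁ a₂ x y z : Fin n} (ba₁ : E T b a₁) (ba₂ : E T b a₂) (a₁≢q : a₁ ≢ q) (a₂≢q : a₂ ≢ q) (a₂≢a₁ : a₂ ≢ a₁)
    (lx : Leaf T x) (ly : Leaf T y) (lz : Leaf T z)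
    (sx : Side T b a₁ x) (sy : Side T b a₂ y) (sz : Side T b q z) where

    open Minimal opt bq branch smaller
    open Rooted T lx

    private
      same-side : ∀ {a c w} → E T b a → E T b c → Leaf T w → Side T b a w → Side T b c w → a ≡ c
      same-side ba bc lw = toward-unique T ba bc (proj₁ lw)

      x≢y : x ≢ y
      x≢y refl = a₂≢a₁ (same-side ba₂ ba₁ ly sy sx)

      x≢z : x ≢ z
      x≢z refl = a₁≢q (same-side ba₁ bq lz sx sz)

      y≢z : y ≢ z
      y≢z refl = a₂≢q (same-side ba₂ bq lz sy sz)

      x-off : Off T b q x
      x-off with true⊎false (side T b q x)
      ... | inj₁ s = contradiction (same-side ba₁ bq lx sx s) a₁≢q
      ... | inj₂ o = o

      -- Only the tree neighbour of `x` has parent `x`. Leaving it out of `P₁` costs the 1 in d(x) -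
      -- 1 and keeps the root out of `A`, so that members of `M` have genuine parents.
      P₁ P₂ P₃ P₄ P₅ A M : Fin n → Bool
      P₁ u = adj G x u ∧ not (does (parent u ≟ x))
      P₂ u = adj G y u ∧ adj G z u
      P₃ u = adj G y u ∨ adj G z u
      P₄ u = isLeafB (sub T) u ∧ not (does (u ≟ x))
      P₅ u = ((isLeafB (sub T) u ∧ not (does (u ≟ x))) ∧ not (does (u ≟ y))) ∧ not (does (u ≟ z))
      A = image parent P₁
      M u = A u ∨ (P₂ u ∨ P₅ u)

      P₅⁻ : ∀ {u} → P₅ u ≡ true → Leaf T u × u ≢ x × u ≢ y × u ≢ z
      P₅⁻ {u} p = isLeafB⇒leaf T (∧-left p₁) , not-does (u ≟ x) (∧-right {isLeafB (sub T) u} p₁)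
                , not-does (u ≟ y) (∧-right p₂) , not-does (u ≟ z) (∧-right p)
        where
        p₂ = ∧-left p
        p₁ = ∧-left p₂

      module _ (nbr-in : ∀ u → ¬ (verts (sub T) u ≡ false × (Adj G x u ⊎ P₃ u ≡ true)))
               (leaf-free : ∀ w → ¬ (isLeafB (sub T) w ≡ true × (Adj G x w ⊎ P₃ w ≡ true))) where

        In-nbr : ∀ {u} → Adj G x u ⊎ P₃ u ≡ true → In T u
        In-nbr {u} p with true⊎false (verts (sub T) u)
        ... | inj₁ u∈ = u∈
        ... | inj₂ u∉ = contradiction (u∉ , p) (nbr-in u)

        not-leaf : ∀ {w} → Adj G x w ⊎ P₃ w ≡ true → ¬ Leaf T w
        not-leaf {w} p lw = leaf-free w (leaf⇒isLeafB T lw , p)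

        nbr-≢x : ∀ {u} → Adj G x u ⊎ P₃ u ≡ true → u ≢ x
        nbr-≢x p refl = not-leaf p lx

        ∧⇒∨ : ∀ {c d} → c ∧ d ≡ true → c ∨ d ≡ true
        ∧⇒∨ {true} _ = refl

        P₂⇒nbr : ∀ {u} → P₂ u ≡ true → Adj G x u ⊎ P₃ u ≡ true
        P₂⇒nbr {u} p = inj₂ (∧⇒∨ {adj G y u} p)

        record Child (u : Fin n) : Set where
          constructor child
          field
            xu : Adj G x u
            up : E T u (parent u)
            sp : Side T u (parent u) x
            p≢x : parent u ≢ x

        P₁⁻ : ∀ {u} → P₁ u ≡ true → Child u
        P₁⁻ {u} p = child xu (proj₁ s) (proj₂ s) (not-does (parent u ≟ x) (∧-right {adj G x u} p))
          where
          xu = ∧-left p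
          s = parent-spec (In-nbr (inj₁ xu)) (nbr-≢x (inj₁ xu))

        M-in : ∀ {p} → M p ≡ true → In T p × p ≢ x
        M-in {p} m with ∨-elim m
        ... | inj₁ a with u , p₁ , refl ← image⁻ parent P₁ a = let open Child (P₁⁻ p₁) in E-tgt T up , p≢x
        ... | inj₂ m′ with ∨-elim m′
        ... | inj₁ p₂ = In-nbr (P₂⇒nbr p₂) , nbr-≢x (P₂⇒nbr p₂)
        ... | inj₂ p₅ = let (lp , p≢x , _) = P₅⁻ p₅ in proj₁ lp , p≢x

        -- The vertices whose parent has degree at most two.
        Thin : Fin n → Set
        Thin p = P₁ p ≡ true ⊎ A p ≡ true ⊎ P₅ p ≡ true ⊎ (P₂ p ≡ true × Side T p (parent p) y)

        thin? : ∀ p → Dec (Thin p)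
        thin? p = (P₁ p ≟ᵇ true) ⊎-dec (A p ≟ᵇ true) ⊎-dec (P₅ p ≟ᵇ true)
                  ⊎-dec ((P₂ p ≟ᵇ true) ×-dec (side T p (parent p) y ≟ᵇ true))

        -- A rotation towards `x` handles neighbours of `x` and, one step further up, their parents.
        -- For common neighbours of `y` and `z` the rotation is towards `y`, which is why `Thin`
        -- asks for `y` on the side of the parent.
        thin-branch : ∀ p → Thin p × 3 ≤ dg T (parent p) → R
        thin-branch p (inj₁ p₁ , d) = rotate-branch opt up lx sp xu p≢x d
          where open Child (P₁⁻ p₁)
        thin-branch p (inj₂ (inj₁ a) , d) with u , p₁ , refl ← image⁻ parent P₁ a =
          let (up′ , sp′) = parent-spec (E-tgt T up) p≢x in next-branch opt up lx sp xu p≢x up′ sp′ d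
          where open Child (P₁⁻ p₁)
        thin-branch p (inj₂ (inj₂ (inj₁ p₅)) , d) =
          let (lp , p≢x , _) = P₅⁻ p₅ in branch-at-leaf opt lp (proj₁ (parent-spec (proj₁ lp) p≢x)) d
        thin-branch p (inj₂ (inj₂ (inj₂ (p₂ , s))) , d) =
          rotate-branch opt (proj₁ (parent-spec (In-nbr (P₂⇒nbr p₂)) (nbr-≢x (P₂⇒nbr p₂)))) ly s (∧-left p₂)
            (λ e → contradiction (≤-trans d (≤-reflexive (trans (cong (dg T) e) (proj₂ ly)))) λ { (s≤s ()) }) d

        A-P₂ : ∀ p → A p ≡ true × P₂ p ≡ true → R
        A-P₂ p (a , p₂) with u , p₁ , refl ← image⁻ parent P₁ a =
          rotate-adjacent opt up lx sp xu ly lz (x≢y ∘ sym) (x≢z ∘ sym) (y≢z ∘ sym) (∧-left p₂)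
          where open Child (P₁⁻ p₁)

        -- From `b` the leaves `x`, `y`, `z` lie in three directions, so an edge that cuts `z` off
        -- from the other two must lie in the direction of `z`. If `b` were on the side of `u`, then
        -- `x` and `y` would share a direction from `b`.
        towards-b : ∀ {u v} → E T u v → Side T u v x → Side T u v y → Off T u v z → Side T b q u
        towards-b {u} {v} uv ux uy uz with b ≟ u
        ... | yes refl = contradiction (trans (same-side ba₂ uv ly sy uy) (sym (same-side ba₁ uv lx sx ux))) a₂≢a₁
        ... | no b≢u with a , ba , su ← toward T (E-src T bq) (E-src T uv) b≢u with true⊎false (side T u v b)
        ... | inj₁ sb = subst (λ c → Side T b c u) (same-side ba bq lz
                (side-nested T (E-sym T uv) ba (Side⇒Off T uv (E-src T bq) sb) (side-tgt T (E-sym T uv)) (E-src T uv) su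
                             (proj₁ lz) (Off⇒Side T uv (proj₁ lz) uz)) sz) su
        ... | inj₂ ob = contradiction (trans (same-side ba₂ ba ly sy (beyond ly uy))
                                             (sym (same-side ba₁ ba lx sx (beyond lx ux)))) a₂≢a₁
          where
          sv : Side T b a v
          sv with true⊎false (side T b a v)
          ... | inj₁ s = s
          ... | inj₂ o with refl , _ ← side-cross T ba (E-sym T uv) o su = clash (side-tgt T uv) ob
          beyond : ∀ {w} → Leaf T w → Side T u v w → Side T b a w
          beyond lw = side-nested T uv ba ob (side-tgt T uv) (E-tgt T uv) sv (proj₁ lw)

        module _ {u : Fin n} (p₂ : P₂ u ≡ true) where
          private
            v = parent u
            yu : Adj G y u
            yu = ∧-left p₂
            zu = ∧-right {adj G y u} p₂
            u∈ = In-nbr (P₂⇒nbr p₂)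
            spec = parent-spec u∈ (nbr-≢x (P₂⇒nbr p₂))
            uv = proj₁ spec
            ux = proj₂ spec

          -- If `z` lies beyond `uv`, rotating towards `z` makes `v` a leaf adjacent to `y`. If `y`
          -- lies below `u`, rotating towards `y` makes `u` a leaf adjacent to `z`. In the remaining
          -- position `u` is beyond `bq`, and minimality decides.
          P₂-parent-y : Adj G y v → R
          P₂-parent-y yv with true⊎false (side T u v z) | true⊎false (side T u v y)
          ... | inj₁ s | _ = rotate-adjacent opt uv lz s zu ly lx y≢z x≢z x≢y yv
          ... | inj₂ _ | inj₂ o =
            rotate-adjacent opt (E-sym T uv) ly (Off⇒Side T uv (proj₁ ly) o) yv lz lx (y≢z ∘ sym) x≢y x≢z zu
          ... | inj₂ o | inj₁ s =
            side-nonadjacent ba₂ a₂≢q ly sy lx x-off x≢y u∈ (towards-b uv ux s o) yu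

          -- The rotations mirror those for `y`, but the last position does not, because minimality
          -- concerns the part that contains `z`. There `uv` may lie outside that part, and then `z`
          -- can be moved out of it into `uv`.
          P₂-parent-z : Adj G z v → R
          P₂-parent-z zv with true⊎false (side T u v y) | true⊎false (side T u v z)
          ... | inj₁ s | _ = rotate-adjacent opt uv ly s yu lz lx (y≢z ∘ sym) x≢y x≢z zv
          ... | inj₂ _ | inj₂ o =
            rotate-adjacent opt (E-sym T uv) lz (Off⇒Side T uv (proj₁ lz) o) zv ly lx y≢z x≢z x≢y yu
          ... | inj₂ _ | inj₁ s with true⊎false (side T b q u)
          ... | inj₁ su = side-nonadjacent ba₂ a₂≢q ly sy lx x-off x≢y u∈ su yu
          ... | inj₂ ou = no-insertion lz sz uv ou ov zu zv
            where
            ov : Off T b q v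
            ov with true⊎false (side T b q v)
            ... | inj₂ o = o
            -- Otherwise `uv` would be `bq`, and `x`, which lies beyond `uv`, would lie beyond `bq`.
            ... | inj₁ sv with u≡b , v≡q ← side-cross T bq uv ou sv =
              clash (subst (λ c → Side T b c x) v≡q (subst (λ c → Side T c v x) u≡b ux)) x-off

        parent-P₃ : ∀ p → M p ≡ true × P₃ (parent p) ≡ true → R
        parent-P₃ p (m , p₃) with ∨-elim m
        ... | inj₁ a with u , p₁ , refl ← image⁻ parent P₁ a =
          let (up′ , sp′) = parent-spec (E-tgt T up) p≢x
          in [ next-adjacent opt up lx sp xu p≢x up′ sp′ ly lz (x≢y ∘ sym) (x≢z ∘ sym) (y≢z ∘ sym)
             , next-adjacent opt up lx sp xu p≢x up′ sp′ lz ly (x≢z ∘ sym) (x≢y ∘ sym) y≢z ]′ (∨-elim p₃)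
          where open Child (P₁⁻ p₁)
        ... | inj₂ m′ with ∨-elim m′
        ... | inj₁ p₂ = [ P₂-parent-y p₂ , P₂-parent-z p₂ ]′ (∨-elim p₃)
        ... | inj₂ p₅ =
          let (lp , p≢x , p≢y , p≢z) = P₅⁻ p₅
              pr = proj₁ (parent-spec (proj₁ lp) p≢x)
          in [ leaf-nbr-nonadjacent opt ly lp lx (p≢y ∘ sym) x≢y (p≢x ∘ sym) pr
             , leaf-nbr-nonadjacent opt lz lp lx (p≢z ∘ sym) x≢z (p≢x ∘ sym) pr ]′ (∨-elim p₃)

        module _ (thin : ∀ p → ¬ (Thin p × 3 ≤ dg T (parent p)))
                 (A-P₂-disjoint : ∀ p → ¬ (A p ≡ true × P₂ p ≡ true))
                 (parent-not-P₃ : ∀ p → ¬ (M p ≡ true × P₃ (parent p) ≡ true)) where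

          P₁-injective : ∀ {u v} → P₁ u ≡ true → P₁ v ≡ true → parent u ≡ parent v → u ≡ v
          P₁-injective {u} {v} p₁ p₁′ eq with u ≟ v
          ... | yes p = p
          ... | no u≢v = contradiction (inj₁ p₁ , siblings-branch (In-nbr xu) (In-nbr xv) (nbr-≢x xu) (nbr-≢x xv) eq u≢v)
                                       (thin u)
            where
            xu = inj₁ (∧-left p₁)
            xv = inj₁ (∧-left p₁′)

          thin⊎P₂ : ∀ {p} → M p ≡ true → Thin p ⊎ Side T (parent p) p y
          thin⊎P₂ {p} m with ∨-elim m
          ... | inj₁ a = inj₁ (inj₂ (inj₁ a))
          ... | inj₂ m′ with ∨-elim m′
          ... | inj₂ p₅ = inj₁ (inj₂ (inj₂ (inj₁ p₅)))
          ... | inj₁ p₂ with true⊎false (side T p (parent p) y)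
          ... | inj₁ s = inj₁ (inj₂ (inj₂ (inj₂ (p₂ , s))))
          ... | inj₂ o = inj₂ (Off⇒Side T (proj₁ (parent-spec (proj₁ (M-in m)) (proj₂ (M-in m)))) (proj₁ ly) o)

          -- Two members with one parent make it a branch vertex, so neither is thin. Both then have
          -- `y` below them, yet only one child of a vertex can lie in the direction of `y`.
          M-injective : ∀ {u v} → M u ≡ true → M v ≡ true → parent u ≡ parent v → u ≡ v
          M-injective {u} {v} mu mv eq with u ≟ v
          ... | yes p = p
          ... | no u≢v with (u∈ , u≢x) ← M-in mu | (v∈ , v≢x) ← M-in mv with thin⊎P₂ mu | thin⊎P₂ mv
          ... | inj₁ t | _ = contradiction (t , siblings-branch u∈ v∈ u≢x v≢x eq u≢v) (thin u)
          ... | inj₂ _ | inj₁ t = contradiction (t , siblings-branch v∈ u∈ v≢x u≢x (sym eq) (u≢v ∘ sym)) (thin v)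
          ... | inj₂ s | inj₂ s′ = toward-unique T (E-sym T (proj₁ (parent-spec u∈ u≢x)))
            (subst (λ w → E T w v) (sym eq) (E-sym T (proj₁ (parent-spec v∈ v≢x)))) (proj₁ ly) s
            (subst (λ w → Side T w v y) (sym eq) s′)

          A-not-leaf : ∀ {p} → A p ≡ true → ¬ Leaf T p
          A-not-leaf a lp with u , p₁ , refl ← image⁻ parent P₁ a = p≢x (parent-not-leaf (E-src T up) u≢x lp)
            where
            open Child (P₁⁻ p₁)
            u≢x = nbr-≢x (inj₁ xu)

          M-disjoint : ∀ {p} → A p ≡ true → P₂ p ∨ P₅ p ≡ true → ⊥
          M-disjoint {p} a m with ∨-elim m
          ... | inj₁ p₂ = A-P₂-disjoint p (a , p₂)
          ... | inj₂ p₅ = A-not-leaf a (proj₁ (P₅⁻ p₅))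

          Q : Fin n → Bool
          Q u = P₃ u ∨ P₄ u

          image-disjoint : ∀ {v} → image parent M v ≡ true → Q v ≡ true → ⊥
          image-disjoint im qv with p , m , refl ← image⁻ parent M im with ∨-elim qv
          ... | inj₁ p₃ = parent-not-P₃ p (m , p₃)
          ... | inj₂ p₄ = not-does (parent p ≟ x) (∧-right {isLeafB (sub T) (parent p)} p₄)
                (parent-not-leaf (proj₁ (M-in m)) (proj₂ (M-in m)) (isLeafB⇒leaf T (∧-left p₄)))

          covered : ∀ v → image parent M v ∨ Q v ≡ true → In T v
          covered v c with ∨-elim c
          ... | inj₁ im with p , m , refl ← image⁻ parent M im =
            E-tgt T (proj₁ (parent-spec (proj₁ (M-in m)) (proj₂ (M-in m))))
          ... | inj₂ qv with ∨-elim qv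
          ... | inj₁ p₃ = In-nbr (inj₂ p₃)
          ... | inj₂ p₄ = ∧-left (∧-left p₄)

          count-N : count M + (count P₃ + count P₄) ≤ N
          count-N = begin
            count M + (count P₃ + count P₄)          ≤⟨ +-mono-≤ (count-image parent M M-injective)
                                                          (count-disjoint P₃ P₄ λ p₃ p₄ →
                                                            not-leaf (inj₂ p₃) (isLeafB⇒leaf T (∧-left p₄))) ⟩
            count (image parent M) + count Q         ≤⟨ count-disjoint (image parent M) Q image-disjoint ⟩
            count (λ v → image parent M v ∨ Q v)     ≤⟨ count-mono covered ⟩
            size T                                   ≡⟨ size-N opt ⟩
            N                                        ∎
            where open ≤-Reasoning

          count-M : count P₁ + (count P₂ + count P₅) ≤ count M
          count-M = begin
            count P₁ + (count P₂ + count P₅)         ≤⟨ +-mono-≤ (count-image parent P₁ P₁-injective)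
                                                          (count-disjoint P₂ P₅ λ p₂ p₅ →
                                                            not-leaf (P₂⇒nbr p₂) (proj₁ (P₅⁻ p₅))) ⟩
            count A + count (λ u → P₂ u ∨ P₅ u)      ≤⟨ count-disjoint A (λ u → P₂ u ∨ P₅ u) M-disjoint ⟩
            count M ∎
            where open ≤-Reasoning

          -- The one neighbour lost is `x′`, the only vertex that can have the leaf `x` as its
          -- parent.
          deg-x : deg G x ≤ suc (count P₁)
          deg-x with x′ , xx′ , _ ← toward T (proj₁ lx) (proj₁ ly) x≢y =
            ≤-trans (count-remove (adj G x) x′) (s≤s (count-mono λ u p →
              ∧-intro (∧-left p) (cong not (dec-false (parent u ≟ x) λ pu →
                not-does (u ≟ x′) (∧-right {adj G x u} p) (leaf-nbr T (proj₂ lx)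
                  (E-sym T (subst (E T u) pu (proj₁ (parent-spec (In-nbr (inj₁ (∧-left p))) (nbr-≢x (inj₁ (∧-left p)))))))
                  xx′)))))

          leaves-P₄ : suc k ≤ suc (count P₄)
          leaves-P₄ = ≤-trans many (count-remove (isLeafB (sub T)) x)

          leaves-P₅ : suc k ≤ 3 + count P₅
          leaves-P₅ = ≤-trans leaves-P₄ (s≤s (≤-trans (count-remove P₄ y)
            (s≤s (count-remove (λ u → P₄ u ∧ not (does (u ≟ y))) z))))

          degree-bound : deg G x + deg G y + deg G z + 2 * k < N + 4
          -- The leaf bounds are stated for `suc k`, which puts an extra 2 on the left. On the right
          -- the constants 1, 1 and 3 from `deg-x`, `leaves-P₄` and `leaves-P₅`, with 1 for
          -- strictness, make 6.
          degree-bound = +-cancelʳ-≤ 2 _ _ (begin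
            suc (deg G x + deg G y + deg G z + 2 * k) + 2
              ≡⟨ solve 4 (λ a b c d → (con 1 :+ (a :+ b :+ c :+ con 2 :* d)) :+ con 2
                                    := con 1 :+ (a :+ (b :+ c) :+ ((con 1 :+ d) :+ (con 1 :+ d))))
                   refl (deg G x) (deg G y) (deg G z) k ⟩
            suc (deg G x + (deg G y + deg G z) + (suc k + suc k))
              ≤⟨ s≤s (+-mono-≤ (+-mono-≤ deg-x (count-∧-∨ (adj G y) (adj G z))) (+-mono-≤ leaves-P₄ leaves-P₅)) ⟩
            suc (suc (count P₁) + (count P₂ + count P₃) + (suc (count P₄) + (3 + count P₅)))
              ≡⟨ solve 5 (λ a b c d e → con 1 :+ ((con 1 :+ a) :+ (b :+ c) :+ ((con 1 :+ d) :+ (con 3 :+ e)))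
                                     := ((a :+ (b :+ e)) :+ (c :+ d)) :+ con 6)
                   refl (count P₁) (count P₂) (count P₃) (count P₄) (count P₅) ⟩
            count P₁ + (count P₂ + count P₅) + (count P₃ + count P₄) + 6
              ≤⟨ +-monoˡ-≤ 6 (≤-trans (+-monoˡ-≤ _ count-M) count-N) ⟩
            N + 6
              ≡⟨ sym (+-assoc N 4 2) ⟩
            N + 4 + 2 ∎)
            where
            open ≤-Reasoning
            open +-*-Solver

          independent : IndepTriple G x y z
          independent = x≢y , x≢z , y≢z , absent (λ p → not-leaf (inj₁ p) ly) , absent (λ p → not-leaf (inj₁ p) lz)
                      , absent (λ p → not-leaf (inj₂ (cong (_∨ adj G z z) p)) lz)
            where
            absent : ∀ {b} → b ≢ true → b ≡ false
            absent {true}  p = contradiction refl p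
            absent {false} _ = refl

      nbr-outside : ∀ u → verts (sub T) u ≡ false × (Adj G x u ⊎ P₃ u ≡ true) → R
      nbr-outside u (u∉ , inj₁ xu) = leaf-escapes opt lx xu u∉
      nbr-outside u (u∉ , inj₂ p₃) = [ (λ yu → leaf-escapes opt ly yu u∉) , (λ zu → leaf-escapes opt lz zu u∉) ]′ (∨-elim p₃)

      leaf-adjacent : ∀ w → isLeafB (sub T) w ≡ true × (Adj G x w ⊎ P₃ w ≡ true) → R
      leaf-adjacent w (l , inj₁ xw) with w ≟ y
      ... | yes refl = adjacent-leaves opt lx ly lz (x≢z ∘ sym) (y≢z ∘ sym) xw
      ... | no w≢y = adjacent-leaves opt lx (isLeafB⇒leaf T l) ly (x≢y ∘ sym) (w≢y ∘ sym) xw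
      leaf-adjacent w (l , inj₂ p₃) with ∨-elim p₃ | w ≟ x
      ... | inj₁ yw | yes refl = adjacent-leaves opt ly lx lz (y≢z ∘ sym) (x≢z ∘ sym) yw
      ... | inj₁ yw | no w≢x = adjacent-leaves opt ly (isLeafB⇒leaf T l) lx x≢y (w≢x ∘ sym) yw
      ... | inj₂ zw | yes refl = adjacent-leaves opt lz lx ly y≢z (x≢y ∘ sym) zw
      ... | inj₂ zw | no w≢x = adjacent-leaves opt lz (isLeafB⇒leaf T l) lx x≢z (w≢x ∘ sym) zw

    low-degree-sum : (IndepTriple G x y z → deg G x + deg G y + deg G z + 2 * k < N + 4 → R) → R
    low-degree-sum finish =
      search (λ u → (verts (sub T) u ≟ᵇ false) ×-dec ((adj G x u ≟ᵇ true) ⊎-dec (P₃ u ≟ᵇ true))) nbr-outside λ h₁ →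
      search (λ w → (isLeafB (sub T) w ≟ᵇ true) ×-dec ((adj G x w ≟ᵇ true) ⊎-dec (P₃ w ≟ᵇ true))) leaf-adjacent λ h₂ →
      search (λ p → thin? h₁ h₂ p ×-dec (3 ≤? dg T (parent p))) (thin-branch h₁ h₂) λ h₃ →
      search (λ p → (A p ≟ᵇ true) ×-dec (P₂ p ≟ᵇ true)) (A-P₂ h₁ h₂) λ h₄ →
      search (λ p → (M p ≟ᵇ true) ×-dec (P₃ (parent p) ≟ᵇ true)) (parent-P₃ h₁ h₂) λ h₅ →
      finish (independent h₁ h₂ h₃ h₄ h₅) (degree-bound h₁ h₂ h₃ h₄ h₅)

-- The starting tree and the double descent

singleton : ∀ {n} {G : Graph n} → Fin n → Tree G
singleton v .sub .verts w = does (w ≟ v)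
singleton v .sub .edges _ _ = false
singleton v .sub .edges-sub _ _ ()
singleton v .sub .edges-sym _ _ = refl
singleton v .sub .edges-ends _ _ ()
singleton v .base = v , dec-true (v ≟ v) refl
singleton v .conn x y x∈ y∈ with refl ← witness (x ≟ v) x∈ | refl ← witness (y ≟ v) y∈ = ε
singleton v .side _ _ _ = false
singleton v .side-src ()
singleton v .side-tgt ()
singleton v .side-cross ()

singleton-leaves : ∀ {n} {G : Graph n} (v : Fin n) → numLeaves (singleton {G = G} v) ≡ 0
singleton-leaves {n} {G} v = trans (∑-cong none) (∑-0 n)
  where
  T : Tree G
  T = singleton v
  none : ∀ w → 𝟙 (isLeafB (sub T) w) ≡ 0
  none w = 𝟙-false (trans (cong (λ m → verts (sub T) w ∧ (m ≡ᵇ 1)) (∑-0 n)) (∧-zeroʳ _))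

theorem3 : (k : ℕ) → 2 ≤ k → (n : ℕ) → (G : Graph n) → Connected G →
    (t : ℕ) → IsLargestTreeOrder G (k + 1) t →
    (∀ x y z → IndepTriple G x y z → t + 4 ≤ deg G x + deg G y + deg G z + 2 * k) →
    Σ (Subgraph G) λ T → IsTree T × KEnded T k × Dominating T
theorem3 k 2≤k n G (v₀ , connected) t (_ , maximal) heavy =
  -- The fuel `suc t` exceeds the number of possible enlargements, since no tree with at most
  -- `suc k` leaves has more than `t` vertices.
  grow (suc t) (singleton v₀) (≤-trans (≤-reflexive (singleton-leaves {G = G} v₀)) z≤n)
       (m≤n+m (suc t) (size (singleton {G = G} v₀)))
  where
  R : Set
  R = Σ (Subgraph G) λ T → IsTree T × KEnded T k × Dominating T

  dominating : ∀ (T : Tree G) → numLeaves T ≤ k → Dominating (sub T) → R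
  dominating T few dom = sub T , isTree T , few , dom

  bounded : ∀ (T : Tree G) → numLeaves T ≤ suc k → size T ≤ t
  bounded T l = maximal (sub T) (isTree T) (≤-trans l (≤-reflexive (+-comm 1 k)))

  grow : ∀ m (T : Tree G) → numLeaves T ≤ suc k → t < size T + m → R
  grow zero T l lt = contradiction (≤-trans lt (≤-reflexive (+-identityʳ _))) (≤⇒≯ (bounded T l))
  grow (suc m) T l lt = start (numLeaves T ≤? k)
    where
    larger : ∀ (T′ : Tree G) → numLeaves T′ ≤ suc k → size T < size T′ → R
    larger T′ l′ big = grow m T′ l′ (≤-trans lt (≤-trans (≤-reflexive (+-suc (size T) m)) (+-monoˡ-≤ m big)))

    open Optimal connected k 2≤k (size T) dominating larger
    open Configuration connected k 2≤k (size T) dominating larger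

    -- Inner descent at fixed order: a smaller part beyond an edge at a branch vertex returns here,
    -- a larger tree returns to `grow`. Thus no optimal tree has to be chosen in advance; the
    -- present one either leads on or contradicts the degree condition.
    shrink : ∀ s {T′ b q} → Opt T′ → E T′ b q → 3 ≤ dg T′ b → sideSize T′ b q < s → R
    shrink (suc s) {T′} {b} {q} opt bq branch lt′ with numLeaves T′ ≤? k
    ... | yes few = few-leaves opt few
    ... | no many′
      with a₁ , ba₁ , a₁≢q ← pick₂ (edges (sub T′) b) (<⇒≤ branch) q
      with a₂ , ba₂ , a₂≢q , a₂≢a₁ ← pick₃ (edges (sub T′) b) branch q a₁
      with x , lx , sx ← leaf-beyond T′ ba₁ | y , ly , sy ← leaf-beyond T′ ba₂ | z , lz , sz ← leaf-beyond T′ bq =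
      low-degree-sum opt (≰⇒> many′) bq branch
        (λ opt′ e d lt″ → shrink s opt′ e d (≤-trans lt″ (≤-pred lt′)))
        ba₁ ba₂ a₁≢q a₂≢q a₂≢a₁ lx ly lz sx sy sz
        λ indep low → contradiction (≤-trans low (≤-trans (+-monoˡ-≤ 4 (bounded T l)) (heavy x y z indep))) (<-irrefl refl)

    start : Dec (numLeaves T ≤ k) → R
    start (yes few) = few-leaves {T} (refl , l) few
    start (no many)
      with x , bx ← pick₁ (isLeafB (sub T)) (≤-trans (s≤s z≤n) (≰⇒> many))
      with y , by , y≢x ← pick₂ (isLeafB (sub T)) (≤-trans (m≤n⇒m≤1+n 2≤k) (≰⇒> many)) x
      -- More than `k` leaves, with `k` at least 2, are at least three; the third is what makes a
      -- branch vertex exist.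
      with o , bo , o≢x , o≢y ← pick₃ (isLeafB (sub T)) (≤-trans (s≤s 2≤k) (≰⇒> many)) x y
      with b , q , bq , branch , _ ← separate T (isLeafB⇒leaf T bx) (isLeafB⇒leaf T by) (isLeafB⇒leaf T bo)
                                              (y≢x ∘ sym) o≢x o≢y =
      shrink _ {T} (refl , l) bq branch ≤-refl
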